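{- Let $H$ be an edge-ordered forest (with at least one edge) of order chromatic number $2$. Then $\mathrm{ex}_<(n,H)=n\cdot 2^{O(\sqrt{\log n})}$; that is, there is a constant $C=C(H)$ such that for all integers $n\ge 2$, $$\mathrm{ex}_<(n,H)\le n\cdot 2^{C\sqrt{\log n}}.$$
   Context: An edge-ordered graph is a finite simple graph together with a linear order on its edge set. Isomorphisms of edge-ordered graphs must preserve the edge-order, and a subgraph of an edge-ordered graph inherits the edge-order. An edge-ordered graph $G$ contains an edge-ordered graph $H$ if $H$ is isomorphic (as an edge-ordered graph) to a (not necessarily induced) subgraph of $G$; otherwise $G$ avoids $H$. For an edge-ordered graph $H$ with at least one edge, $\mathrm{ex}_<(n,H)$ is the maximal number of edges in an edge-ordered graph on $n$ vertices that avoids $H$. An edge-ordered forest is an edge-ordered graph whose underlying simple graph is a forest. A vertex $v$ of an edge-ordered graph is close if the edges incident to $v$ form an interval in the edge-order (i.e. they are consecutive in the edge-order). For an edge-ordered forest $H$ with at least one edge, "order chromatic number $2$" may be taken to mean: $H$ has a proper $2$-coloring of its vertices such that all vertices in one of the two color classes are close. Here $\log$ is the binary logarithm. -}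

module Defs where

open import Data.Bool using (Bool)
open import Data.Fin using (Fin; zero; suc; inject₁; fromℕ; remQuot; combine; finToFun; funToFin)
import Data.Fin as F
open import Data.Fin.Properties
  using (any?; all?; injective⇒≤; combine-injective; remQuot-combine; finToFun-funToFin)
import Data.Fin.Properties as F
open import Data.Nat using (ℕ; zero; suc; _+_; _*_; _^_; _≤_; _<_; NonZero; s≤s⁻¹)
open import Data.Nat.Properties using (m≤n⇒m<n∨m≡n)
open import Data.Product using (Σ; ∃; ∃₂; _×_; _,_; proj₁; proj₂; uncurry)
open import Data.Product.Properties using (≡-dec)
open import Data.Sum using (_⊎_; inj₁; inj₂)
open import Function using (_∘_)
open import Function.Definitions using (Injective)
open import Relation.Binary.PropositionalEquality
  using (_≡_; _≢_; _≗_; refl; sym; trans; cong; cong₂; subst; subst₂)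
open import Relation.Nullary using (¬_; Dec; yes; no; contradiction)
open import Relation.Nullary.Decidable using (map′; _×-dec_; _⊎-dec_; _→-dec_)
open import Relation.Unary using (Decidable)

-- The linear order on the edge set is given by its increasing enumeration:
-- `edge e` is the e-th smallest edge.  The unordered pair {u , v} is stored
-- as (u , v) with u < v, so `edge` being injective excludes repeated edges.
record EdgeOrderedGraph (n : ℕ) : Set where
  constructor mkGraph
  field
    size           : ℕ
    edge           : Fin size → Fin n × Fin n
    sorted         : ∀ e → proj₁ (edge e) F.< proj₂ (edge e)
    edge-injective : Injective _≡_ _≡_ edge

open EdgeOrderedGraph public

module _ {n : ℕ} (G : EdgeOrderedGraph n) where

  Joins : Fin (size G) → Fin n → Fin n → Set
  Joins e u v = edge G e ≡ (u , v) ⊎ edge G e ≡ (v , u)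

  Adjacent : Fin n → Fin n → Set
  Adjacent u v = ∃ λ e → Joins e u v

  Incident : Fin (size G) → Fin n → Set
  Incident e v = ∃ λ u → Joins e u v

  -- The cycle has length 3 + k.
  record Cycle (k : ℕ) : Set where
    field
      vertex           : Fin (3 + k) → Fin n
      vertex-injective : Injective _≡_ _≡_ vertex
      step             : ∀ (i : Fin (2 + k)) → Adjacent (vertex (inject₁ i)) (vertex (suc i))
      close-up         : Adjacent (vertex (fromℕ (2 + k))) (vertex zero)

  IsForest : Set
  IsForest = ∀ k → ¬ Cycle k

  Close : Fin n → Set
  Close v = ∀ {e f g} → e F.≤ f → f F.≤ g → Incident e v → Incident g v → Incident f v

  Proper : (Fin n → Bool) → Set
  Proper c = ∀ {u v} → Adjacent u v → c u ≢ c v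

  -- Describes order chromatic number 2 only for forests with at least one edge.
  OrderChromaticNumberTwo : Set
  OrderChromaticNumberTwo =
    ∃ λ (c : Fin n → Bool) → Proper c × ∃ λ (b : Bool) → ∀ v → c v ≡ b → Close v

-- The maps φ on vertices and ψ on edges are an isomorphism from H onto the
-- subgraph of G formed by their images, with the edge-order inherited from G.
record IsEmbedding {n h} (G : EdgeOrderedGraph n) (H : EdgeOrderedGraph h)
                   (φ : Fin h → Fin n) (ψ : Fin (size H) → Fin (size G)) : Set where
  constructor mkEmbedding
  field
    φ-injective : Injective _≡_ _≡_ φ
    ψ-monotone  : ∀ {e f} → e F.< f → ψ e F.< ψ f
    ψ-joins     : ∀ {e u v} → Joins H e u v → Joins G (ψ e) (φ u) (φ v)

open IsEmbedding public

Contains : ∀ {n h} → EdgeOrderedGraph n → EdgeOrderedGraph h → Set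
Contains G H = ∃₂ (IsEmbedding G H)

Avoids : ∀ {n h} → EdgeOrderedGraph n → EdgeOrderedGraph h → Set
Avoids G H = ¬ Contains G H

Attains : ∀ {h} → ℕ → EdgeOrderedGraph h → ℕ → Set
Attains n H m = ∃ λ (G : EdgeOrderedGraph n) → size G ≡ m × Avoids G H

IsEx : ∀ {h} → ℕ → EdgeOrderedGraph h → ℕ → Set
IsEx n H m = Attains n H m × (∀ (G : EdgeOrderedGraph n) → Avoids G H → size G ≤ m)

-- m ≤ n · 2^(C √log₂ k) as an inequality of real numbers, for k ≥ 1.  Since
-- x ↦ n · 2^(C x) is continuous and nondecreasing, it holds exactly when
-- m ≤ n · 2^(C p/q) for every rational p/q ≥ √log₂ k.  The latter condition on
-- p/q is k^(q²) ≤ 2^(p²), and m ≤ n · 2^(C p/q) is m^q ≤ n^q · 2^(C p).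
infix 4 _≤_·2^⟨_·√log₂_⟩

_≤_·2^⟨_·√log₂_⟩ : ℕ → ℕ → ℕ → ℕ → Set
m ≤ n ·2^⟨ C ·√log₂ k ⟩ =
  ∀ p q → .{{_ : NonZero q}} → k ^ (q * q) ≤ 2 ^ (p * p) → m ^ q ≤ n ^ q * 2 ^ (C * p)

∃-fun? : ∀ {a b} {P : (Fin a → Fin b) → Set} →
         (∀ {f g} → f ≗ g → P f → P g) → Decidable P → Dec (∃ P)
∃-fun? {P = P} resp P? =
  map′ (λ (k , p) → finToFun k , p)
       (λ (f , p) → funToFin f , resp (λ i → sym (finToFun-funToFin f i)) p)
       (any? (λ k → P? (finToFun k)))

joins? : ∀ {n} (G : EdgeOrderedGraph n) e u v → Dec (Joins G e u v)
joins? G e u v = ≡-dec F._≟_ F._≟_ _ _ ⊎-dec ≡-dec F._≟_ F._≟_ _ _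

isEmbedding? : ∀ {n h} (G : EdgeOrderedGraph n) (H : EdgeOrderedGraph h) φ ψ →
               Dec (IsEmbedding G H φ ψ)
isEmbedding? G H φ ψ =
  map′ (λ (i , m , j) → mkEmbedding (λ {x} {y} → i x y) (λ {e} {f} → m e f) (λ {e} {u} {v} → j e u v))
       (λ E → (λ _ _ → φ-injective E) , (λ _ _ → ψ-monotone E) , (λ _ _ _ → ψ-joins E))
       (all? (λ x → all? λ y → (φ x F.≟ φ y) →-dec (x F.≟ y))
        ×-dec all? (λ e → all? λ f → (e F.<? f) →-dec (ψ e F.<? ψ f))
        ×-dec all? (λ e → all? λ u → all? λ v →
                joins? H e u v →-dec joins? G (ψ e) (φ u) (φ v)))

isEmbedding-resp : ∀ {n h} {G : EdgeOrderedGraph n} {H : EdgeOrderedGraph h} {φ φ′ ψ ψ′} →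
                   φ ≗ φ′ → ψ ≗ ψ′ → IsEmbedding G H φ ψ → IsEmbedding G H φ′ ψ′
isEmbedding-resp {G = G} p q E = mkEmbedding
  (λ {x} {y} eq → φ-injective E (trans (p x) (trans eq (sym (p y)))))
  (λ {e} {f} lt → subst₂ F._<_ (q e) (q f) (ψ-monotone E lt))
  (λ {e} {u} {v} j →
     subst₂ (Joins G _) (p u) (p v) (subst (λ e′ → Joins G e′ _ _) (q e) (ψ-joins E j)))

contains? : ∀ {n h} (G : EdgeOrderedGraph n) (H : EdgeOrderedGraph h) → Dec (Contains G H)
contains? G H =
  ∃-fun? (λ p (ψ , E) → ψ , isEmbedding-resp p (λ _ → refl) E)
         (λ φ → ∃-fun? (isEmbedding-resp (λ _ → refl)) (isEmbedding? G H φ))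

EdgesValid : ∀ {n m} → (Fin m → Fin n × Fin n) → Set
EdgesValid f = (∀ e → proj₁ (f e) F.< proj₂ (f e)) × (∀ e e′ → f e ≡ f e′ → e ≡ e′)

validGraph : ∀ {n m} (f : Fin m → Fin n × Fin n) → EdgesValid f → EdgeOrderedGraph n
validGraph f (s , i) = mkGraph _ f s (i _ _)

contains-resp : ∀ {n h m} {H : EdgeOrderedGraph h} {f g : Fin m → Fin n × Fin n} {v w} →
                f ≗ g → Contains (validGraph f v) H → Contains (validGraph g w) H
contains-resp {H = H} {f} {g} {v} {w} p (φ , ψ , E) =
  φ , ψ , mkEmbedding (φ-injective E) (ψ-monotone E) joins
  where
  joins : ∀ {e x y} → Joins H e x y → Joins (validGraph g w) (ψ e) (φ x) (φ y)
  joins {e} j with ψ-joins E j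
  ... | inj₁ eq = inj₁ (trans (sym (p (ψ e))) eq)
  ... | inj₂ eq = inj₂ (trans (sym (p (ψ e))) eq)

AvoidingEdges : ∀ {n h m} → EdgeOrderedGraph h → (Fin m → Fin n × Fin n) → Set
AvoidingEdges H f = Σ (EdgesValid f) λ v → Avoids (validGraph f v) H

edgesValid? : ∀ {n m} (f : Fin m → Fin n × Fin n) → Dec (EdgesValid f)
edgesValid? f =
  all? (λ e → proj₁ (f e) F.<? proj₂ (f e))
  ×-dec all? (λ e → all? λ e′ → ≡-dec F._≟_ F._≟_ (f e) (f e′) →-dec (e F.≟ e′))

avoidingEdges? : ∀ {n h m} (H : EdgeOrderedGraph h) (f : Fin m → Fin n × Fin n) →
                 Dec (AvoidingEdges H f)
avoidingEdges? H f with edgesValid? f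
... | no ¬v = no (¬v ∘ proj₁)
... | yes v with contains? (validGraph f v) H
...   | no ¬c = yes (v , ¬c)
...   | yes c = no λ (_ , ¬c) → ¬c (contains-resp (λ _ → refl) c)

avoidingEdges-resp : ∀ {n h m} (H : EdgeOrderedGraph h) {f g : Fin m → Fin n × Fin n} →
                     f ≗ g → AvoidingEdges H f → AvoidingEdges H g
avoidingEdges-resp H p ((s , i) , a) =
  ( (λ e → subst (λ x → proj₁ x F.< proj₂ x) (p e) (s e))
  , (λ e e′ eq → i e e′ (trans (p e) (trans eq (sym (p e′))))) )
  , λ c → a (contains-resp (λ x → sym (p x)) c)

attains? : ∀ {h} n (H : EdgeOrderedGraph h) → Decidable (Attains n H)
attains? n H m =
  map′ (λ (_ , v , a) → validGraph _ v , refl , a)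
       (λ { (mkGraph _ f s i , refl , a) →
            uncurry combine ∘ f
          , avoidingEdges-resp H (λ e → sym (remQuot-combine (proj₁ (f e)) (proj₂ (f e))))
                                 ((s , λ _ _ → i) , a) })
       (∃-fun? (λ p → avoidingEdges-resp H (λ e → cong (remQuot n) (p e)))
               (λ f → avoidingEdges? H (remQuot n ∘ f)))

size≤n*n : ∀ {n} (G : EdgeOrderedGraph n) → size G ≤ n * n
size≤n*n G = injective⇒≤ {f = uncurry combine ∘ edge G} λ {e} {e′} eq →
  edge-injective G (uncurry (cong₂ _,_) (combine-injective _ _ _ _ eq))

maximum : ∀ {P : ℕ → Set} → Decidable P → P 0 → ∀ b → (∀ m → P m → m ≤ b) →
          ∃ λ m → P m × (∀ k → P k → k ≤ m)
maximum P? p₀ zero    ≤b = 0 , p₀ , ≤b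
maximum {P} P? p₀ (suc b) ≤b with P? (suc b)
... | yes p = suc b , p , ≤b
... | no ¬p = maximum P? p₀ b λ m pm → below m pm (m≤n⇒m<n∨m≡n (≤b m pm))
  where
  below : ∀ m → P m → m < suc b ⊎ m ≡ suc b → m ≤ b
  below m _  (inj₁ lt)   = s≤s⁻¹ lt
  below m pm (inj₂ refl) = contradiction pm ¬p

empty : ∀ n → EdgeOrderedGraph n
empty n = mkGraph 0 (λ ()) (λ ()) (λ { {()} })

empty-avoids : ∀ {h} n (H : EdgeOrderedGraph h) → 0 < size H → Avoids (empty n) H
empty-avoids n (mkGraph (suc _) _ _ _) _ (_ , ψ , _) = contradiction (ψ zero) λ ()

ex-exists : ∀ {h} n (H : EdgeOrderedGraph h) → 0 < size H → ∃ (IsEx n H)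
ex-exists n H 0<
  with m , p , max ← maximum (attains? n H) (empty n , refl , empty-avoids n H 0<) (n * n)
                       (λ { _ (G , refl , _) → size≤n*n G })
  = m , p , λ G a → max (size G) (G , refl , a)

ex : ∀ {h} → ℕ → (H : EdgeOrderedGraph h) → 0 < size H → ℕ
ex n H 0< = proj₁ (ex-exists n H 0<)

ex-isEx : ∀ {h} n (H : EdgeOrderedGraph h) (0< : 0 < size H) → IsEx n H (ex n H 0<)
ex-isEx n H 0< = proj₂ (ex-exists n H 0<)

{-# OPTIONS --safe #-}
module Submission where

-- Let q be the number of edges of H.  The claim is proved for edge-ordered graphs with all edges
-- inside a vertex set V, by induction on r with |V| < 2^(T r): such a graph avoiding H has at most
-- D|V| edges, where D grows by the constant factor K = 16 q + 4 in each step and starts at 2^O(T).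
-- Taking T about √log n, some T + 1 steps suffice.
--
-- For the inductive step cut the edge-order into t = K 2^T intervals of equal length.  A vertex is
-- heavy in an interval that contains at least 8D of its edges.  By induction (or trivially, if too
-- many vertices are heavy in it) an interval has few edges with two heavy ends, and altogether this
-- accounts for at most a quarter of the edges.  The other edges have a light end, so many vertices
-- have many edges in at least q different intervals each.  Since the degrees involved may be
-- polynomially large in t, these vertices may be taken to have the same q intervals in common.
--
-- Inside a set U of such vertices the stars of H are embedded one by one, each
-- into its own common interval, with arbitrary center and leaves in U; since the centers of the
-- stars are close, only the order within each star is then left to arrange.  A forest has
-- a star meeting the other stars in at most one vertex, so all but one leaf of the star to be added
-- can be chosen freely.  For this to succeed the edge at the given leaf must have many edges into U
-- both before and after it in the interval at the new center.  Discarding the vertices of U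
-- without enough such edges costs O(|V|) edges, and q + 1 rounds of this suffice.

open import Defs
open import Data.Bool using (Bool)
import Data.Bool.Properties as Bool
open import Data.Empty using (⊥)
open import Data.Fin using (Fin; zero; suc; toℕ; fromℕ<; inject≤; finToFun; funToFin)
open import Data.Fin.Properties using (any?; all?; pigeonhole; ¬∀⟶∃¬; finToFun-funToFin)
import Data.Fin.Properties as F
import Data.Fin as F
open import Data.Nat using (ℕ; zero; suc; _+_; _*_; _∸_; _^_; _/_; _%_; _≤_; _<_; _≤?_; _<?_;
  z≤n; s≤s; z<s; s<s; NonZero; >-nonZero; >-nonZero⁻¹; ≢-nonZero)
open import Data.Nat.DivMod using (m<n*o⇒m/o<n; m/n*n≤m; m%n<n; m≡m%n+[m/n]*n; /-monoˡ-≤)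
open import Data.Nat.Properties
open import Data.Nat.Tactic.RingSolver using (solve-∀)
open import Data.Product using (∃; ∃₂; _×_; _,_; proj₁; proj₂)
open import Data.Sum using (_⊎_; inj₁; inj₂; swap)
open import Data.Unit using (⊤)
open import Function using (_∘_; id)
open import Function.Definitions using (Injective)
open import Relation.Binary using (Tri; tri<; tri≈; tri>)
open import Relation.Binary.PropositionalEquality hiding (J)
open import Relation.Nullary using (¬_; Dec; yes; no; contradiction; ¬?)
open import Relation.Nullary.Decidable using (_×-dec_; _→-dec_; decidable-stable)
open import Relation.Unary using (Decidable)
open import Algebra.Properties.Semiring.Sum +-*-semiring
  using (sum; sum-cong-≗; ∑-distrib-+; ∑-comm; *-distribˡ-sum)

private variable
  m n k : ℕ

-- Sums and cardinalities

sum-mono-≤ : {f g : Fin n → ℕ} → (∀ i → f i ≤ g i) → sum f ≤ sum g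
sum-mono-≤ {zero}  _   = z≤n
sum-mono-≤ {suc n} f≤g = +-mono-≤ (f≤g zero) (sum-mono-≤ (f≤g ∘ suc))

sum-mono-< : {f g : Fin n → ℕ} → (∀ i → f i ≤ g i) → ∀ i → f i < g i → sum f < sum g
sum-mono-< {suc n} f≤g zero    lt = +-mono-<-≤ lt (sum-mono-≤ (f≤g ∘ suc))
sum-mono-< {suc n} f≤g (suc i) lt = +-mono-≤-< (f≤g zero) (sum-mono-< (f≤g ∘ suc) i lt)

sum-const : ∀ n c → sum {n} (λ _ → c) ≡ n * c
sum-const zero    c = refl
sum-const (suc n) c = cong (c +_) (sum-const n c)

sum-≤-const : ∀ {c} {f : Fin n → ℕ} → (∀ i → f i ≤ c) → sum f ≤ n * c
sum-≤-const {n} {c} f≤c = ≤-trans (sum-mono-≤ f≤c) (≤-reflexive (sum-const n c))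

term≤sum : (f : Fin n → ℕ) → ∀ i → f i ≤ sum f
term≤sum f zero    = m≤m+n _ _
term≤sum f (suc i) = ≤-trans (term≤sum (f ∘ suc) i) (m≤n+m _ _)

-- The Iverson bracket: cardinalities become sums of it, so double counting is an exchange of sums
-- by `∑-comm`.
⟦_⟧ : {A : Set} → Dec A → ℕ
⟦ yes _ ⟧ = 1
⟦ no _  ⟧ = 0

module _ {A B : Set} where

  ⟦⟧-mono : (a : Dec A) (b : Dec B) → (A → B) → ⟦ a ⟧ ≤ ⟦ b ⟧
  ⟦⟧-mono (no _)  _       _ = z≤n
  ⟦⟧-mono (yes a) (yes b) _ = ≤-refl
  ⟦⟧-mono (yes a) (no ¬b) f = contradiction (f a) ¬b

*⟦⟧≤ : ∀ {A : Set} (a : Dec A) {c k} → (A → c ≤ k) → c * ⟦ a ⟧ ≤ k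
*⟦⟧≤ (yes a) {c} f = ≤-trans (≤-reflexive (*-identityʳ c)) (f a)
*⟦⟧≤ (no _)  {c} f = ≤-trans (≤-reflexive (*-zeroʳ c)) z≤n

⟦⟧≤ : ∀ {A : Set} (a : Dec A) {k} → (A → 1 ≤ k) → ⟦ a ⟧ ≤ k
⟦⟧≤ (yes a) f = f a
⟦⟧≤ (no _)  f = z≤n

⟦⟧-true : ∀ {A : Set} (a : Dec A) → A → 1 ≤ ⟦ a ⟧
⟦⟧-true (yes _) _ = ≤-refl
⟦⟧-true (no ¬a) a = contradiction a ¬a

⟦⟧-false : ∀ {A : Set} (a : Dec A) → ¬ A → ⟦ a ⟧ ≤ 0
⟦⟧-false (yes a) ¬a = contradiction a ¬a
⟦⟧-false (no _)  _  = ≤-refl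

count : {P : Fin m → Set} → Decidable P → ℕ
count P? = sum (λ x → ⟦ P? x ⟧)

-- The enumeration is increasing, so a decidable set of edges can serve as the edge set of a
-- subgraph with the inherited order.
enum : {P : Fin m → Set} (P? : Decidable P) → Fin (count P?) → ∃ P
enum {m = suc m} P? i with P? zero
enum {m = suc m} P? zero    | yes p = zero , p
enum {m = suc m} P? (suc i) | yes p = let x , q = enum (P? ∘ suc) i in suc x , q
enum {m = suc m} P? i       | no _  = let x , q = enum (P? ∘ suc) i in suc x , q

enum-mono : {P : Fin m → Set} (P? : Decidable P) → ∀ {i j} → i F.< j →
            proj₁ (enum P? i) F.< proj₁ (enum P? j)
enum-mono {m = suc m} P? {i} {j} i<j with P? zero
enum-mono {m = suc m} P? {zero}  {suc j} i<j       | yes p = z<s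
enum-mono {m = suc m} P? {suc i} {suc j} (s<s i<j) | yes p = s<s (enum-mono (P? ∘ suc) i<j)
enum-mono {m = suc m} P? i<j | no _ = s<s (enum-mono (P? ∘ suc) i<j)

mono⇒injective : {f : Fin m → Fin n} → (∀ {i j} → i F.< j → f i F.< f j) →
                 ∀ {i j} → f i ≡ f j → i ≡ j
mono⇒injective {f = f} f-mono {i} {j} eq with F.<-cmp i j
... | tri< i<j _ _ = contradiction eq (F.<⇒≢ (f-mono i<j))
... | tri≈ _ i≡j _ = i≡j
... | tri> _ _ j<i = contradiction (sym eq) (F.<⇒≢ (f-mono j<i))

abstract

  enum≤ : {P : Fin m → Set} (P? : Decidable P) → k ≤ count P? →
          ∃ λ (f : Fin k → Fin m) → (∀ i → P (f i)) × (∀ {i j} → i F.< j → f i F.< f j)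
  enum≤ P? k≤ = (λ i → proj₁ (enum P? (inject≤ i k≤)))
              , (λ i → proj₂ (enum P? (inject≤ i k≤)))
              , λ {i} {j} i<j → enum-mono P?
                  (subst₂ _<_ (sym (F.toℕ-inject≤ i k≤)) (sym (F.toℕ-inject≤ j k≤)) i<j)

module _ {P : Fin m → Set} (P? : Decidable P) where

  abstract

    count>0⇒∃ : 0 < count P? → ∃ P
    count>0⇒∃ 0< = enum P? (fromℕ< 0<)

  ∃⇒count>0 : ∀ {x} → P x → 0 < count P?
  ∃⇒count>0 {x} p = ≤-trans (⟦⟧-true (P? x) p) (term≤sum _ x)

  count-≤-injection : (f : ∀ x → P x → Fin k) → (∀ {x y} p q → f x p ≡ f y q → x ≡ y) →
                      count P? ≤ k
  count-≤-injection f f-inj = F.injective⇒≤ {f = λ i → f _ (proj₂ (enum P? i))}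
    λ eq → mono⇒injective (enum-mono P?) (f-inj _ _ eq)

  count≤1 : (∀ {x y} → P x → P y → x ≡ y) → count P? ≤ 1
  count≤1 unique = count-≤-injection {k = 1} (λ _ _ → zero) λ p q _ → unique p q

  count-≤-interval : (g : Fin m → ℕ) → ∀ a → (∀ {x y} → P x → P y → g x ≡ g y → x ≡ y) →
                     (∀ {x} → P x → a ≤ g x × g x < a + k) → count P? ≤ k
  count-≤-interval g a g-inj range = count-≤-injection
    (λ x p → fromℕ< (below p))
    (λ {x} {y} p q eq → g-inj p q (begin
      g x              ≡⟨ m∸n+n≡m (proj₁ (range p)) ⟨
      g x ∸ a + a      ≡⟨ cong (_+ a) (F.toℕ-fromℕ< (below p)) ⟨
      toℕ (fromℕ< (below p)) + a ≡⟨ cong (λ i → toℕ i + a) eq ⟩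
      toℕ (fromℕ< (below q)) + a ≡⟨ cong (_+ a) (F.toℕ-fromℕ< (below q)) ⟩
      g y ∸ a + a      ≡⟨ m∸n+n≡m (proj₁ (range q)) ⟩
      g y              ∎))
    where
    open ≡-Reasoning
    below : ∀ {x} → P x → g x ∸ a < _
    below {x} p = +-cancelˡ-< a _ _ (subst (_< a + _) (sym (m+[n∸m]≡n (proj₁ (range p)))) (proj₂ (range p)))

module _ {P Q : Fin m → Set} (P? : Decidable P) (Q? : Decidable Q) where

  count-mono : (∀ {x} → P x → Q x) → count P? ≤ count Q?
  count-mono P⊆Q = sum-mono-≤ λ x → ⟦⟧-mono (P? x) (Q? x) P⊆Q

  count-mono-< : (∀ {x} → P x → Q x) → ∀ {x} → ¬ P x → Q x → count P? < count Q?
  count-mono-< P⊆Q {x} ¬p q = sum-mono-< (λ x → ⟦⟧-mono (P? x) (Q? x) P⊆Q) x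
    (≤-trans (s≤s (⟦⟧-false (P? x) ¬p)) (⟦⟧-true (Q? x) q))

-- Walks and fresh edges

module _ {n : ℕ} (G : EdgeOrderedGraph n) where

  joins-sym : ∀ {e u v} → Joins G e u v → Joins G e v u
  joins-sym = swap

  joins⇒≢ : ∀ {e u v} → Joins G e u v → u ≢ v
  joins⇒≢ {e} j refl = F.<-irrefl refl (subst (λ p → proj₁ p F.< proj₂ p) (loop j) (sorted G e))
    where
    loop : ∀ {u} → Joins G e u u → edge G e ≡ (u , u)
    loop (inj₁ eq) = eq
    loop (inj₂ eq) = eq

  joins-ends : ∀ {e u v x y} → Joins G e u v → Joins G e x y → (x ≡ u × y ≡ v) ⊎ (x ≡ v × y ≡ u)
  joins-ends (inj₁ p) (inj₁ q) with refl ← trans (sym p) q = inj₁ (refl , refl)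
  joins-ends (inj₁ p) (inj₂ q) with refl ← trans (sym p) q = inj₂ (refl , refl)
  joins-ends (inj₂ p) (inj₁ q) with refl ← trans (sym p) q = inj₂ (refl , refl)
  joins-ends (inj₂ p) (inj₂ q) with refl ← trans (sym p) q = inj₁ (refl , refl)

  other-end-unique : ∀ {e u v w} → Joins G e u v → Joins G e u w → v ≡ w
  other-end-unique j k with joins-ends j k
  ... | inj₁ (_ , w≡v)   = sym w≡v
  ... | inj₂ (u≡v , w≡u) = sym (trans w≡u u≡v)

  edge-unique : ∀ {e f u v} → Joins G e u v → Joins G f u v → e ≡ f
  edge-unique (inj₁ p) (inj₁ q) = edge-injective G (trans p (sym q))
  edge-unique (inj₂ p) (inj₂ q) = edge-injective G (trans p (sym q))
  edge-unique {e} {f} (inj₁ p) (inj₂ q) = contradiction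
    (subst (λ x → proj₁ x F.< proj₂ x) p (sorted G e))
    (F.<-asym (subst (λ x → proj₁ x F.< proj₂ x) q (sorted G f)))
  edge-unique {e} {f} (inj₂ p) (inj₁ q) = contradiction
    (subst (λ x → proj₁ x F.< proj₂ x) p (sorted G e))
    (F.<-asym (subst (λ x → proj₁ x F.< proj₂ x) q (sorted G f)))

  module _ (w : ℕ → Fin n) (adjacent : ∀ i → Adjacent G (w i) (w (suc i)))
           (no-backtracking : ∀ i → w i ≢ w (2 + i)) where

    private
      -- Lengths 1 and 2 are excluded: the former would be a loop, the latter a backtracking. A
      -- closed stretch of at least three steps without inner repetition is a cycle.
      injective⇒cycle : ∀ d i → (∀ {a b : Fin (suc d)} → a F.< b → w (i + toℕ a) ≢ w (i + toℕ b)) →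
                        w i ≡ w (i + suc d) → ∃ (Cycle G)
      injective⇒cycle zero i _ eq =
        contradiction (trans eq (cong w (+-comm i 1))) (joins⇒≢ (proj₂ (adjacent i)))
      injective⇒cycle (suc zero) i _ eq =
        contradiction (trans eq (cong w (+-comm i 2))) (no-backtracking i)
      injective⇒cycle (suc (suc k)) i distinct eq = k , record
        { vertex           = λ a → w (i + toℕ a)
        ; vertex-injective = injective
        ; step             = λ a → subst₂ (Adjacent G)
            (cong (λ x → w (i + x)) (sym (F.toℕ-inject₁ a))) (cong w (sym (+-suc i (toℕ a))))
            (adjacent (i + toℕ a))
        ; close-up         = subst₂ (Adjacent G)
            (cong (λ x → w (i + x)) (sym (F.toℕ-fromℕ (2 + k))))
            (trans (cong w (sym (+-suc i (2 + k)))) (trans (sym eq) (cong w (sym (+-identityʳ i)))))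
            (adjacent (i + (2 + k)))
        }
        where
        injective : ∀ {a b} → w (i + toℕ a) ≡ w (i + toℕ b) → a ≡ b
        injective {a} {b} eq′ with F.<-cmp a b
        ... | tri< a<b _ _ = contradiction eq′ (distinct a<b)
        ... | tri≈ _ a≡b _ = a≡b
        ... | tri> _ _ b<a = contradiction (sym eq′) (distinct b<a)

      -- An inner repetition bounds a strictly shorter closed stretch, so descent ends in a stretch
      -- without inner repetitions; `k` bounds the descent.
      repetition⇒cycle : ∀ k d i → d ≤ k → w i ≡ w (i + suc d) → ∃ (Cycle G)
      repetition⇒cycle k d i d≤k eq
        with any? (λ (a : Fin (suc d)) → any? λ b → (a F.<? b) ×-dec (w (i + toℕ a) F.≟ w (i + toℕ b)))
      ... | no ¬rep = injective⇒cycle d i (λ a<b eq′ → ¬rep (_ , _ , a<b , eq′)) eq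
      repetition⇒cycle zero zero i d≤k eq | yes (zero , zero , () , _)
      repetition⇒cycle (suc k) d i d≤k eq | yes (a , b , a<b , eq′) =
        repetition⇒cycle k (toℕ b ∸ suc (toℕ a)) (i + toℕ a)
          (m∸suc≤k (≤-trans (≤-pred (F.toℕ<n b)) d≤k))
          (trans eq′ (cong w (sym (begin
            i + toℕ a + suc (toℕ b ∸ suc (toℕ a))   ≡⟨ +-assoc i _ _ ⟩
            i + (toℕ a + suc (toℕ b ∸ suc (toℕ a))) ≡⟨ cong (i +_) (+-suc (toℕ a) _) ⟩
            i + (suc (toℕ a) + (toℕ b ∸ suc (toℕ a))) ≡⟨ cong (i +_) (m+[n∸m]≡n a<b) ⟩
            i + toℕ b ∎))))
        where
        open ≡-Reasoning
        m∸suc≤k : ∀ {x} → x ≤ suc k → x ∸ suc (toℕ a) ≤ k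
        m∸suc≤k {zero}  _       = z≤n
        m∸suc≤k {suc x} (s≤s p) = ≤-trans (m∸n≤m x (toℕ a)) p

    walk⇒cycle : ∃ (Cycle G)
    walk⇒cycle with i , j , i<j , eq ← pigeonhole (n<1+n n) (w ∘ toℕ) =
      repetition⇒cycle _ (toℕ j ∸ suc (toℕ i)) (toℕ i) ≤-refl
        (trans eq (cong w (sym (trans (+-suc _ _) (m+[n∸m]≡n i<j)))))

  -- The graph is simple, so each of the `h` vertices `φ x` excludes at most one edge at `v`. Hence
  -- the summand `h` in the thresholds below.
  fresh-count : ∀ {h c} {P : Fin (size G) → Set} (P? : Decidable P) (φ : Fin h → Fin n) v →
                h + c ≤ count P? →
                c ≤ count (λ e → P? e ×-dec ¬? (any? λ x → joins? G e v (φ x)))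
  fresh-count {h} {c} {P} P? φ v h+c≤ = +-cancelˡ-≤ h _ _ (begin
    h + c                                             ≤⟨ h+c≤ ⟩
    count P?                                          ≤⟨ sum-mono-≤ split ⟩
    sum (λ e → sum (λ x → ⟦ joins? G e v (φ x) ⟧) + ⟦ Q? e ⟧)
      ≡⟨ ∑-distrib-+ (λ e → sum (λ x → ⟦ joins? G e v (φ x) ⟧)) (λ e → ⟦ Q? e ⟧) ⟩
    sum (λ e → sum (λ x → ⟦ joins? G e v (φ x) ⟧)) + count Q?
      ≡⟨ cong (_+ count Q?) (∑-comm (λ e x → ⟦ joins? G e v (φ x) ⟧)) ⟩
    sum (λ x → count (λ e → joins? G e v (φ x))) + count Q?
      ≤⟨ +-monoˡ-≤ (count Q?) (sum-≤-const λ x → count≤1 (λ e → joins? G e v (φ x)) edge-unique) ⟩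
    h * 1 + count Q?                                  ≡⟨ cong (_+ count Q?) (*-identityʳ h) ⟩
    h + count Q?                                      ∎)
    where
    open ≤-Reasoning
    Q? : Decidable (λ e → P e × ¬ ∃ λ x → Joins G e v (φ x))
    Q? e = P? e ×-dec ¬? (any? λ x → joins? G e v (φ x))
    split : ∀ e → ⟦ P? e ⟧ ≤ sum (λ x → ⟦ joins? G e v (φ x) ⟧) + ⟦ Q? e ⟧
    split e with P? e | any? (λ x → joins? G e v (φ x))
    ... | no _  | _          = z≤n
    ... | yes p | no _       = m≤n+m 1 _
    ... | yes p | yes (x , j) = ≤-trans (≤-trans (⟦⟧-true (joins? G e v (φ x)) j)
                                          (term≤sum (λ x → ⟦ joins? G e v (φ x) ⟧) x)) (m≤m+n _ _)

-- Stars of H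

-- Each edge e of H is split into its end α e in the class of close vertices and its end β e in
-- the other class; the edges with a given value of α then form an interval.
record StarDecomposition {h} (H : EdgeOrderedGraph h) : Set where
  field
    α β      : Fin (size H) → Fin h
    joins    : ∀ e → Joins H e (α e) (β e)
    disjoint : ∀ e f → α e ≢ β f
    interval : ∀ {e f g} → e F.≤ f → f F.≤ g → α e ≡ α g → α f ≡ α e

module _ {h} (H : EdgeOrderedGraph h) where

  -- An edge meeting a vertex of the close class has it as its `α`, the other end being in the other
  -- class. Closeness of `α e` then says that its star is an interval.
  starDecomposition : OrderChromaticNumberTwo H → StarDecomposition H
  starDecomposition (c , proper , b , close) = record
    { α        = α
    ; β        = β
    ; joins    = joins
    ; disjoint = λ e f eq → cβ f (trans (sym (cong c eq)) (cα e))
    ; interval = λ {e} {f} {g} e≤f f≤g eq → α-unique f (cα e)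
        (close (α e) (cα e) e≤f f≤g (β e , joins-sym H (joins e))
               (β g , joins-sym H (subst (λ a → Joins H g a (β g)) (sym eq) (joins g))))
    }
    where
    split : ∀ e → ∃₂ λ x y → Joins H e x y × c x ≡ b × c y ≢ b
    split e with c (proj₁ (edge H e)) Bool.≟ b
    ... | yes p = _ , _ , inj₁ refl , p , λ q → proper (e , inj₁ refl) (trans p (sym q))
    ... | no ¬p = _ , _ , inj₂ refl ,
      trans (Bool.¬-not (λ eq → proper (e , inj₁ refl) (sym eq))) (sym (Bool.¬-not (¬p ∘ sym))) , ¬p
    α β : Fin (size H) → Fin h
    α e = proj₁ (split e)
    β e = proj₁ (proj₂ (split e))
    joins : ∀ e → Joins H e (α e) (β e)
    joins e = proj₁ (proj₂ (proj₂ (split e)))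
    cα : ∀ e → c (α e) ≡ b
    cα e = proj₁ (proj₂ (proj₂ (proj₂ (split e))))
    cβ : ∀ e → c (β e) ≢ b
    cβ e = proj₂ (proj₂ (proj₂ (proj₂ (split e))))
    α-unique : ∀ f {a} → c a ≡ b → Incident H f a → α f ≡ a
    α-unique f ca (u , j) with joins-ends H (joins f) (joins-sym H j)
    ... | inj₁ (eq , _) = sym eq
    ... | inj₂ (refl , _) = contradiction ca (cβ f)

module StarProperties {h} {H : EdgeOrderedGraph h} (stars : StarDecomposition H) where
  open StarDecomposition stars

  β-injective : ∀ {e f} → α e ≡ α f → β e ≡ β f → e ≡ f
  β-injective {e} {f} p q =
    edge-unique H (joins e) (subst₂ (Joins H f) (sym p) (sym q) (joins f))

  private
    pick : ∀ {v} (e : Fin (size H)) → Dec (∃ λ f → α f ≡ v) → Fin (size H)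
    pick e (yes (f , _)) = f
    pick e (no _)        = e

    pick-α : ∀ {e v} d → α e ≡ v → α (pick {v} e d) ≡ v
    pick-α (yes (_ , p)) _ = p
    pick-α (no ¬p)       q = contradiction (_ , q) ¬p

    pick-≡ : ∀ {e f v} d → α e ≡ v → pick {v} e d ≡ pick f d
    pick-≡ (yes _) _ = refl
    pick-≡ (no ¬p) q = contradiction (_ , q) ¬p

  -- Stars are indexed by one of their edges, found by a search that depends on `α e` only. The
  -- fallback value of `pick` never occurs here, as `e` itself lies in the star.
  label : Fin (size H) → Fin (size H)
  label e = pick e (any? λ f → α f F.≟ α e)

  label-α : ∀ e → α (label e) ≡ α e
  label-α e = pick-α (any? λ f → α f F.≟ α e) refl

  label-cong : ∀ {e f} → α e ≡ α f → label e ≡ label f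
  label-cong {e} {f} eq =
    trans (pick-≡ {f = f} (any? λ g → α g F.≟ α e) refl)
          (cong (λ v → pick f (any? λ g → α g F.≟ v)) eq)

  -- With equal labels the stars coincide. With reversed labels either `e` lies between `label f`
  -- and `f`, or `label f` lies between `e` and `label e`; the interval property then merges the
  -- stars.
  label-mono : ∀ {e f} → α e ≢ α f → e F.< f → label e F.< label f
  label-mono {e} {f} α≢ e<f with F.<-cmp (label e) (label f)
  ... | tri< lt _ _ = lt
  ... | tri≈ _ eq _ = contradiction (trans (sym (label-α e)) (trans (cong α eq) (label-α f))) α≢
  ... | tri> _ _ gt with ≤-total (toℕ (label f)) (toℕ e)
  ...   | inj₁ le = contradiction
          (trans (interval le (<⇒≤ e<f) (label-α f)) (label-α f)) α≢
  ...   | inj₂ ge = contradiction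
          (trans (sym (interval ge (<⇒≤ gt) (sym (label-α e)))) (label-α f)) α≢

  module _ (forest : IsForest H) {R : Fin (size H) → Set} (R? : Decidable R)
           (closed : ∀ {e f} → α e ≡ α f → R e → R f) where

    -- Within `R` the star may share only the leaf `β ε` with other stars; the image of this leaf is
    -- prescribed when the star is embedded.
    LeafStar : Fin (size H) → Set
    LeafStar ε = ∀ e f → α e ≡ α ε → e ≢ ε → R f → α f ≢ α ε → β e ≢ β f

    private
      LeafStarAt : Fin (size H) → Fin (size H) → Fin (size H) → Set
      LeafStarAt ε e f = α e ≡ α ε → e ≢ ε → R f → α f ≢ α ε → β e ≢ β f

      leafStarAt? : ∀ ε e f → Dec (LeafStarAt ε e f)
      leafStarAt? ε e f = (α e F.≟ α ε) →-dec ¬? (e F.≟ ε) →-dec R? f →-dec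
                          ¬? (α f F.≟ α ε) →-dec ¬? (β e F.≟ β f)

      State : Set
      State = ∃ λ ε → R ε

      -- A star that is not a leaf star can be left through an edge other than the one it was
      -- entered by.
      Exit : State → Set
      Exit (ε , _) = ∃₂ λ e f → α e ≡ α ε × e ≢ ε × R f × α f ≢ α ε × β e ≡ β f

      module Walk (exit : ∀ s → Exit s) where

        next : State → State
        next s = let _ , f , _ , _ , r , _ = exit s in f , r

        -- Centers and shared leaves alternate. At a leaf the walk does not turn back because the
        -- next star is a different one, at a center because the exit edge differs from the entering
        -- edge.
        walk : State → ℕ → Fin h
        walk s zero          = α (proj₁ s)
        walk s (suc zero)    = β (proj₁ (exit s))
        walk s (suc (suc i)) = walk (next s) i

        walk-adjacent : ∀ s i → Adjacent H (walk s i) (walk s (suc i))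
        walk-adjacent s zero with e , f , α≡ , _ ← exit s =
          e , subst (λ a → Joins H e a (β e)) α≡ (joins e)
        walk-adjacent s (suc zero) with e , f , _ , _ , _ , _ , β≡ ← exit s =
          f , subst (λ b → Joins H f b (α f)) (sym β≡) (joins-sym H (joins f))
        walk-adjacent s (suc (suc i)) = walk-adjacent (next s) i

        walk-no-backtracking : ∀ s i → walk s i ≢ walk s (2 + i)
        walk-no-backtracking s zero eq = let _ , _ , _ , _ , _ , α≢ , _ = exit s in α≢ (sym eq)
        walk-no-backtracking s (suc zero) eq =
          let _ , _ , _ , _ , _ , _ , β≡ = exit s
              _ , _ , α≡ , e≢ , _ = exit (next s)
          in e≢ (β-injective α≡ (trans (sym eq) β≡))
        walk-no-backtracking s (suc (suc i)) = walk-no-backtracking (next s) i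

    -- If there were no leaf star, every star could be left again, and an infinite walk without
    -- backtracking in a finite graph gives a cycle.
    leaf-star : ∃ R → ∃ λ ε → R ε × LeafStar ε
    leaf-star s₀
      with any? (λ ε → R? ε ×-dec all? λ e → all? λ f → leafStarAt? ε e f)
    ... | yes (ε , r , leaf) = ε , r , leaf
    ... | no ¬leaf = contradiction (proj₂ cycle) (forest (proj₁ cycle))
      where
      exit : ∀ s → Exit s
      exit (ε , r)
        with e , ¬e ← ¬∀⟶∃¬ _ (λ e → ∀ f → LeafStarAt ε e f) (λ e → all? (leafStarAt? ε e))
                        (λ leaf → ¬leaf (ε , r , leaf))
        with f , ¬f ← ¬∀⟶∃¬ _ (LeafStarAt ε e) (leafStarAt? ε e) ¬e =
        e , f
        , decidable-stable (_ F.≟ _) (λ k → ¬f λ a → contradiction a k)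
        , (λ k → ¬f λ _ a → contradiction k a)
        , decidable-stable (R? f) (λ k → ¬f λ _ _ a → contradiction a k)
        , (λ k → ¬f λ _ _ _ a → contradiction k a)
        , decidable-stable (_ F.≟ _) (λ k → ¬f λ _ _ _ _ a → k a)
      open Walk exit
      cycle : ∃ (Cycle H)
      cycle = walk⇒cycle H (walk s₀) (walk-adjacent s₀) (walk-no-backtracking s₀)

-- Unions, and the first and last elements of a finite set

count-∪ : {P Q R : Fin m → Set} (P? : Decidable P) (Q? : Decidable Q) (R? : Decidable R) →
          (∀ {x} → P x → Q x ⊎ R x) → count P? ≤ count Q? + count R?
count-∪ P? Q? R? P⊆Q∪R = ≤-trans (sum-mono-≤ split) (≤-reflexive (∑-distrib-+ (λ x → ⟦ Q? x ⟧) (λ x → ⟦ R? x ⟧)))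
  where
  split : ∀ x → ⟦ P? x ⟧ ≤ ⟦ Q? x ⟧ + ⟦ R? x ⟧
  split x = ⟦⟧≤ (P? x) λ p → by-cases (P⊆Q∪R p)
    where
    by-cases : _ → 1 ≤ ⟦ Q? x ⟧ + ⟦ R? x ⟧
    by-cases (inj₁ q) = ≤-trans (⟦⟧-true (Q? x) q) (m≤m+n _ _)
    by-cases (inj₂ r) = ≤-trans (⟦⟧-true (R? x) r) (m≤n+m _ _)

module _ {P : Fin m → Set} (P? : Decidable P) where

  Below Above : Fin m → Fin m → Set
  Below x y = P y × y F.< x
  Above x y = P y × x F.< y

  below? : ∀ x → Decidable (Below x)
  below? x y = P? y ×-dec (y F.<? x)

  above? : ∀ x → Decidable (Above x)
  above? x y = P? y ×-dec (x F.<? y)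

  #below #above : Fin m → ℕ
  #below x = count (below? x)
  #above x = count (above? x)

  #below-mono : ∀ {x y} → P x → x F.< y → #below x < #below y
  #below-mono {x} {y} p x<y = count-mono-< (below? x) (below? y)
    (λ (q , z<x) → q , F.<-trans z<x x<y) (λ (_ , x<x) → F.<-irrefl refl x<x) (p , x<y)

  #above-mono : ∀ {x y} → P y → x F.< y → #above y < #above x
  #above-mono {x} {y} p x<y = count-mono-< (above? y) (above? x)
    (λ (q , y<z) → q , F.<-trans x<y y<z) (λ (_ , y<y) → F.<-irrefl refl y<y) (p , x<y)

  module _ (k : ℕ) where

    First Last : Fin m → Set
    First x = P x × #below x < k
    Last  x = P x × #above x < k

    first? : Decidable First
    first? x = P? x ×-dec (#below x <? k)

    last? : Decidable Last
    last? x = P? x ×-dec (#above x <? k)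

    count-first : count first? ≤ k
    count-first = count-≤-interval first? #below 0 injective (λ (_ , lt) → z≤n , lt)
      where
      injective : ∀ {x y} → First x → First y → #below x ≡ #below y → x ≡ y
      injective {x} {y} (p , _) (q , _) eq with F.<-cmp x y
      ... | tri< x<y _ _ = contradiction eq (<⇒≢ (#below-mono p x<y))
      ... | tri≈ _ x≡y _ = x≡y
      ... | tri> _ _ y<x = contradiction (sym eq) (<⇒≢ (#below-mono q y<x))

    count-last : count last? ≤ k
    count-last = count-≤-interval last? #above 0 injective (λ (_ , lt) → z≤n , lt)
      where
      injective : ∀ {x y} → Last x → Last y → #above x ≡ #above y → x ≡ y
      injective {x} {y} (p , _) (q , _) eq with F.<-cmp x y
      ... | tri< x<y _ _ = contradiction (sym eq) (<⇒≢ (#above-mono q x<y))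
      ... | tri≈ _ x≡y _ = x≡y
      ... | tri> _ _ y<x = contradiction eq (<⇒≢ (#above-mono p y<x))

-- Rounds of refinement

DecSet : ℕ → Set₁
DecSet n = ∃ λ (P : Fin n → Set) → Decidable P

∣_∣ : ∀ {n} → DecSet n → ℕ
∣ _ , P? ∣ = count P?

module Levels {n q} (G : EdgeOrderedGraph n) (h : ℕ)
  {V : Fin n → Set} (V? : Decidable V) (ends-V : ∀ {e u v} → Joins G e u v → V u)
  {Zone : Fin q → Fin (size G) → Set} (Zone? : ∀ i → Decidable (Zone i))
  where

  -- Room for a star on one side of a given edge: `q` edges remain to choose from once the at most
  -- `h` edges to used vertices are excluded.
  margin : ℕ
  margin = h + q

  degree : Fin q → Fin n → ℕ
  degree i u = count (λ e → Zone? i e ×-dec any? (joins? G e u))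

  module _ (vertices : DecSet n) where

    private
      U : Fin n → Set
      U = proj₁ vertices

      U? : Decidable U
      U? = proj₂ vertices

    InStar : Fin n → Fin q → Fin (size G) → Set
    InStar v i e = Zone i e × ∃ λ u → U u × Joins G e u v

    inStar? : ∀ v i → Decidable (InStar v i)
    inStar? v i e = Zone? i e ×-dec any? λ u → U? u ×-dec joins? G e u v

    -- Such an edge can be the image of any edge of a star of `H` to be centered at `v`, whatever
    -- the rank of that edge in its star.
    Central : Fin n → Fin q → Fin (size G) → Set
    Central v i e = margin ≤ #below (inStar? v i) e × margin ≤ #above (inStar? v i) e

    central? : ∀ v i → Decidable (Central v i)
    central? v i e = (margin ≤? #below (inStar? v i) e) ×-dec (margin ≤? #above (inStar? v i) e)

    Usable : Fin n → Fin q → Fin (size G) → Set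
    Usable u i e = Zone i e × ∃ λ v → Joins G e u v × Central v i e

    usable? : ∀ u i → Decidable (Usable u i)
    usable? u i e = Zone? i e ×-dec any? λ v → joins? G e u v ×-dec central? v i e

    -- Among `h + 1` usable edges at `u`, one leads to a center different from `h` vertices already
    -- placed.
    refine : DecSet n
    refine = (λ u → U u × ∀ i → h + 1 ≤ count (usable? u i))
           , (λ u → U? u ×-dec all? λ i → h + 1 ≤? count (usable? u i))

    private
      Marginal : Fin n → Fin q → Fin (size G) → Set
      Marginal v i e = InStar v i e × ¬ Central v i e

      marginal? : ∀ v i → Decidable (Marginal v i)
      marginal? v i e = inStar? v i e ×-dec ¬? (central? v i e)

      -- A marginal edge is among the first or the last `margin` edges of its star. The factor
      -- `⟦ V? v ⟧` makes the total over all `v` proportional to the size of `V` instead of `n`.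
      count-marginal : ∀ v i → count (marginal? v i) ≤ 2 * margin * ⟦ V? v ⟧
      count-marginal v i with V? v
      ... | no ¬v = ≤-trans
        (≮⇒≥ λ 0< → let _ , (_ , _ , _ , j) , _ = count>0⇒∃ (marginal? v i) 0<
                    in ¬v (ends-V (joins-sym G j)))
        z≤n
      ... | yes _ = begin
        count (marginal? v i)
          ≤⟨ count-∪ (marginal? v i) (first? star margin) (last? star margin) split ⟩
        count (first? star margin) + count (last? star margin)
          ≤⟨ +-mono-≤ (count-first star margin) (count-last star margin) ⟩
        margin + margin  ≡⟨ cong (margin +_) (sym (+-identityʳ margin)) ⟩
        2 * margin       ≡⟨ sym (*-identityʳ (2 * margin)) ⟩
        2 * margin * 1   ∎
        where
        open ≤-Reasoning
        star = inStar? v i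
        split : ∀ {e} → Marginal v i e → First star margin e ⊎ Last star margin e
        split {e} (s , ¬c) with margin ≤? #below star e
        ... | yes p = inj₂ (s , ≰⇒> λ p′ → ¬c (p , p′))
        ... | no ¬p = inj₁ (s , ≰⇒> ¬p)

      lost? : ∀ u i v → Decidable (λ e → Joins G e u v × Marginal v i e)
      lost? u i v e = joins? G e u v ×-dec marginal? v i e

      lost : Fin n → Fin q → Fin n → ℕ
      lost u i v = count (lost? u i v)

      degree≤usable+lost : ∀ {u} → U u → ∀ i → degree i u ≤ count (usable? u i) + sum (lost u i)
      degree≤usable+lost {u} Uu i = begin
        degree i u
          ≤⟨ sum-mono-≤ split ⟩
        sum (λ e → ⟦ usable? u i e ⟧ + sum (λ v → ⟦ lost? u i v e ⟧))
          ≡⟨ ∑-distrib-+ (λ e → ⟦ usable? u i e ⟧) (λ e → sum (λ v → ⟦ lost? u i v e ⟧)) ⟩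
        count (usable? u i) + sum (λ e → sum (λ v → ⟦ lost? u i v e ⟧))
          ≡⟨ cong (count (usable? u i) +_) (∑-comm (λ e v → ⟦ lost? u i v e ⟧)) ⟩
        count (usable? u i) + sum (lost u i) ∎
        where
        open ≤-Reasoning
        split : ∀ e → ⟦ Zone? i e ×-dec any? (joins? G e u) ⟧ ≤
                      ⟦ usable? u i e ⟧ + sum (λ v → ⟦ lost? u i v e ⟧)
        split e = ⟦⟧≤ (Zone? i e ×-dec any? (joins? G e u)) λ (z , v , j) → by-cases z v j (central? v i e)
          where
          by-cases : Zone i e → ∀ v → Joins G e u v → Dec (Central v i e) →
                     1 ≤ ⟦ usable? u i e ⟧ + sum (λ v → ⟦ lost? u i v e ⟧)
          by-cases z v j (yes c) = ≤-trans (⟦⟧-true (usable? u i e) (z , v , j , c)) (m≤m+n _ _)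
          by-cases z v j (no ¬c) = ≤-trans
            (≤-trans (⟦⟧-true (lost? u i v e) (j , (z , u , Uu , j) , ¬c))
                     (term≤sum (λ v → ⟦ lost? u i v e ⟧) v))
            (m≤n+m _ _)

      -- A marginal edge at `v` is lost to only one vertex, its other end.
      sum-lost≤ : ∀ i v → sum (λ u → lost u i v) ≤ 2 * margin * ⟦ V? v ⟧
      sum-lost≤ i v = begin
        sum (λ u → lost u i v)                            ≡⟨ ∑-comm (λ u e → ⟦ lost? u i v e ⟧) ⟩
        sum (λ e → count (λ u → lost? u i v e))           ≤⟨ sum-mono-≤ one-tail ⟩
        count (marginal? v i)                             ≤⟨ count-marginal v i ⟩
        2 * margin * ⟦ V? v ⟧                             ∎
        where
        open ≤-Reasoning
        one-tail : ∀ e → count (λ u → lost? u i v e) ≤ ⟦ marginal? v i e ⟧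
        one-tail e with marginal? v i e in eq
        ... | yes m = count≤1 (λ u → joins? G e u v ×-dec yes m)
                        λ (j , _) (k , _) → other-end-unique G (joins-sym G j) (joins-sym G k)
        ... | no ¬m = ≮⇒≥ λ 0< → ¬m (proj₂ (proj₂ (count>0⇒∃ (λ u → joins? G e u v ×-dec no ¬m) 0<)))

    -- A vertex is discarded because in some zone at most `h` of its at least `h + g` edges are
    -- usable. At least `g` are then lost, and all lost edges together are counted at their centers.
    refine-loss : ∀ {g} → (∀ {u} → U u → ∀ i → h + g ≤ degree i u) →
                  g * count U? ≤ g * ∣ refine ∣ + q * (2 * margin * count V?)
    refine-loss {g} deg≥ = begin
      g * count U?                                            ≡⟨ *-distribˡ-sum g (λ u → ⟦ U? u ⟧) ⟩
      sum (λ u → g * ⟦ U? u ⟧)                                ≤⟨ sum-mono-≤ split ⟩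
      sum (λ u → g * ⟦ proj₂ refine u ⟧ + sum (λ i → sum (lost u i)))
        ≡⟨ ∑-distrib-+ (λ u → g * ⟦ proj₂ refine u ⟧) (λ u → sum (λ i → sum (lost u i))) ⟩
      sum (λ u → g * ⟦ proj₂ refine u ⟧) + sum (λ u → sum (λ i → sum (lost u i)))
        ≡⟨ cong₂ _+_ (sym (*-distribˡ-sum g (λ u → ⟦ proj₂ refine u ⟧)))
                     (∑-comm (λ u i → sum (lost u i))) ⟩
      g * ∣ refine ∣ + sum (λ i → sum (λ u → sum (lost u i)))
        ≤⟨ +-monoʳ-≤ (g * ∣ refine ∣) (sum-≤-const per-zone) ⟩
      g * ∣ refine ∣ + q * (2 * margin * count V?)            ∎
      where
      open ≤-Reasoning
      per-zone : ∀ i → sum (λ u → sum (lost u i)) ≤ 2 * margin * count V?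
      per-zone i = begin
        sum (λ u → sum (lost u i))               ≡⟨ ∑-comm (λ u v → lost u i v) ⟩
        sum (λ v → sum (λ u → lost u i v))       ≤⟨ sum-mono-≤ (sum-lost≤ i) ⟩
        sum (λ v → 2 * margin * ⟦ V? v ⟧)        ≡⟨ *-distribˡ-sum (2 * margin) (λ v → ⟦ V? v ⟧) ⟨
        2 * margin * count V?                    ∎
      split : ∀ u → g * ⟦ U? u ⟧ ≤ g * ⟦ proj₂ refine u ⟧ + sum (λ i → sum (lost u i))
      split u = *⟦⟧≤ (U? u) λ Uu → by-cases Uu (F.any? λ i → ¬? (h + 1 ≤? count (usable? u i)))
        where
        by-cases : U u → Dec (∃ λ i → ¬ (h + 1 ≤ count (usable? u i))) →
                   g ≤ g * ⟦ proj₂ refine u ⟧ + sum (λ i → sum (lost u i))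
        by-cases Uu (yes (i , few)) = ≤-trans (+-cancelˡ-≤ h _ _ (begin
          h + g                                    ≤⟨ deg≥ Uu i ⟩
          degree i u                               ≤⟨ degree≤usable+lost Uu i ⟩
          count (usable? u i) + sum (lost u i)
            ≤⟨ +-monoˡ-≤ (sum (lost u i)) (≤-pred (subst (count (usable? u i) <_) (+-comm h 1) (≰⇒> few))) ⟩
          h + sum (lost u i)                       ∎))
          (≤-trans (term≤sum (λ i → sum (lost u i)) i) (m≤n+m _ _))
        by-cases Uu (no enough) = ≤-trans
          (m≤m*n g 1)
          (≤-trans (*-monoʳ-≤ g (⟦⟧-true (proj₂ refine u)
                     (Uu , λ i → decidable-stable (_ ≤? _) λ ¬p → enough (i , ¬p))))
                   (m≤m+n _ _))

  module _ (U₀ : DecSet n) where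

    level : ℕ → DecSet n
    level zero    = U₀
    level (suc s) = refine (level s)

    level-⊆ : ∀ s {u} → proj₁ (level s) u → proj₁ U₀ u
    level-⊆ zero    = id
    level-⊆ (suc s) = level-⊆ s ∘ proj₁

    level-antitone : ∀ s k {u} → proj₁ (level (s + k)) u → proj₁ (level s) u
    level-antitone s zero    {u} p = subst (λ r → proj₁ (level r) u) (+-identityʳ s) p
    level-antitone s (suc k) {u} p =
      proj₁ (level-antitone (suc s) k {u} (subst (λ r → proj₁ (level r) u) (+-suc s k) p))

    level-loss : ∀ {g} → (∀ {u} → proj₁ U₀ u → ∀ i → h + g ≤ degree i u) → ∀ s →
                 g * ∣ U₀ ∣ ≤ g * ∣ level s ∣ + s * (q * (2 * margin * count V?))
    level-loss {g} deg≥ zero    = m≤m+n _ _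
    level-loss {g} deg≥ (suc s) = begin
      g * ∣ U₀ ∣                              ≤⟨ level-loss deg≥ s ⟩
      g * ∣ level s ∣ + s * X                 ≤⟨ +-monoˡ-≤ (s * X) (refine-loss (level s) (deg≥ ∘ level-⊆ s)) ⟩
      g * ∣ level (suc s) ∣ + X + s * X       ≡⟨ +-assoc (g * ∣ level (suc s) ∣) X (s * X) ⟩
      g * ∣ level (suc s) ∣ + (X + s * X)     ∎
      where
      open ≤-Reasoning
      X = q * (2 * margin * count V?)

-- Embedding H star by star

module Embedding {n h} (G : EdgeOrderedGraph n) (H : EdgeOrderedGraph h) (nonempty : 0 < size H)
  (forest : IsForest H) (stars : StarDecomposition H)
  {V : Fin n → Set} (V? : Decidable V) (ends-V : ∀ {e u v} → Joins G e u v → V u)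
  {Zone : Fin (size H) → Fin (size G) → Set} (Zone? : ∀ i → Decidable (Zone i))
  (zone-mono : ∀ {i j e f} → i F.< j → Zone i e → Zone j f → e F.< f)
  (U₀ : DecSet n)
  where

  open StarDecomposition stars
  open StarProperties stars
  open Levels G h V? ends-V Zone?

  U : ℕ → Fin n → Set
  U s = proj₁ (level U₀ s)

  -- ψ is meaningful only on the edges in R.
  record PartialEmbedding (R : Fin (size H) → Set) (s : ℕ) : Set where
    field
      φ           : Fin h → Fin n
      ψ           : Fin (size H) → Fin (size G)
      φ-injective : Injective _≡_ _≡_ φ
      φ-β         : ∀ e → U s (φ (β e))
      ψ-zone      : ∀ {e} → R e → Zone (label e) (ψ e)
      ψ-joins     : ∀ {e} → R e → Joins G (ψ e) (φ (α e)) (φ (β e))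
      ψ-monotone  : ∀ {e f} → R e → R f → α e ≡ α f → e F.< f → ψ e F.< ψ f

  usable-edge : ∀ s u → U (suc s) u → ∀ i (φ : Fin h → Fin n) →
                ∃ λ e → Usable (level U₀ s) u i e × ¬ ∃ λ x → Joins G e u (φ x)
  usable-edge s u (_ , many) i φ =
    count>0⇒∃ (λ e → usable? (level U₀ s) u i e ×-dec ¬? (any? λ x → joins? G e u (φ x)))
      (fresh-count G (usable? (level U₀ s) u i) φ u (many i))

  -- Images are provided for all edges of H, although only those of the star of ε will be used: in
  -- this way their order needs no renumbering.
  record StarImage (s : ℕ) (u : Fin n) (i ε : Fin (size H)) (φ : Fin h → Fin n) : Set where
    field
      center     : Fin n
      image      : Fin (size H) → Fin (size G)
      tail       : Fin (size H) → Fin n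
      zone       : ∀ e → Zone i (image e)
      tail-U     : ∀ e → U s (tail e)
      tail-joins : ∀ e → Joins G (image e) (tail e) center
      image-mono : ∀ {e f} → e F.< f → image e F.< image f
      tail-ε     : tail ε ≡ u
      center-new : ∀ x → φ x ≢ center
      tail-new   : ∀ {e} → e ≢ ε → ∀ x → φ x ≢ tail e

  module _ {s u} {φ : Fin h → Fin n} (i ε : Fin (size H)) (Uu : U s u)
           {e* v} (zone* : Zone i e*) (joins* : Joins G e* u v) where

    private
      star? : Decidable (InStar (level U₀ s) v i)
      star? = inStar? (level U₀ s) v i

      Fresh : Fin (size G) → Set
      Fresh e = ¬ ∃ λ x → Joins G e v (φ x)

      fresh? : Decidable Fresh
      fresh? e = ¬? (any? λ x → joins? G e v (φ x))

      Choice : (Fin (size G) → Set) → Set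
      Choice P = ∃ λ (f : Fin (size H) → Fin (size G)) →
                   (∀ e → P (f e) × Fresh (f e)) × (∀ {e e′} → e F.< e′ → f e F.< f e′)

      choose : ∀ {P : Fin (size G) → Set} (P? : Decidable P) → margin ≤ count P? → Choice P
      choose P? many = enum≤ (λ e → P? e ×-dec fresh? e) (fresh-count G P? φ v many)

      module Around (before : Choice (Below star? e*)) (after : Choice (Above star? e*)) where

        place : ∀ e → Tri (e F.< ε) (e ≡ ε) (ε F.< e) → Fin (size G)
        place e (tri< _ _ _) = proj₁ before e
        place e (tri≈ _ _ _) = e*
        place e (tri> _ _ _) = proj₁ after e

        place-star : ∀ e t → InStar (level U₀ s) v i (place e t)
        place-star e (tri< _ _ _) = proj₁ (proj₁ (proj₁ (proj₂ before) e))
        place-star e (tri≈ _ _ _) = zone* , u , Uu , joins*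
        place-star e (tri> _ _ _) = proj₁ (proj₁ (proj₁ (proj₂ after) e))

        place-fresh : ∀ e t → e ≢ ε → Fresh (place e t)
        place-fresh e (tri< _ _ _)  _   = proj₂ (proj₁ (proj₂ before) e)
        place-fresh e (tri≈ _ eq _) e≢ε = contradiction eq e≢ε
        place-fresh e (tri> _ _ _)  _   = proj₂ (proj₁ (proj₂ after) e)

        place-mono : ∀ {e f} t t′ → e F.< f → place e t F.< place f t′
        place-mono (tri< _ _ _)    (tri< _ _ _)    e<f = proj₂ (proj₂ before) e<f
        place-mono (tri< _ _ _)    (tri≈ _ _ _)    _   = proj₂ (proj₁ (proj₁ (proj₂ before) _))
        place-mono (tri< _ _ _)    (tri> _ _ _)    _   =
          F.<-trans (proj₂ (proj₁ (proj₁ (proj₂ before) _))) (proj₂ (proj₁ (proj₁ (proj₂ after) _)))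
        place-mono (tri≈ _ refl _) (tri< f<e _ _)  e<f = contradiction f<e (F.<-asym e<f)
        place-mono (tri≈ _ refl _) (tri≈ _ refl _) e<f = contradiction e<f (F.<-irrefl refl)
        place-mono (tri≈ _ refl _) (tri> _ _ _)    _   = proj₂ (proj₁ (proj₁ (proj₂ after) _))
        place-mono (tri> _ _ ε<e)  (tri< f<ε _ _)  e<f =
          contradiction (F.<-trans e<f f<ε) (F.<-asym ε<e)
        place-mono (tri> _ _ ε<e)  (tri≈ _ refl _) e<f = contradiction e<f (F.<-asym ε<e)
        place-mono (tri> _ _ _)    (tri> _ _ _)    e<f = proj₂ (proj₂ after) e<f

        place-ε : ∀ t {w} → Joins G (place ε t) w v → w ≡ u
        place-ε (tri< _ ≢ _) _ = contradiction refl ≢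
        place-ε (tri≈ _ _ _) j = other-end-unique G (joins-sym G j) (joins-sym G joins*)
        place-ε (tri> _ ≢ _) _ = contradiction refl ≢

        starImage : (∀ x → φ x ≢ v) → StarImage s u i ε φ
        starImage v-new = record
          { center     = v
          ; image      = λ e → place e (F.<-cmp e ε)
          ; tail       = λ e → proj₁ (proj₂ (star e))
          ; zone       = λ e → proj₁ (star e)
          ; tail-U     = λ e → proj₁ (proj₂ (proj₂ (star e)))
          ; tail-joins = λ e → proj₂ (proj₂ (proj₂ (star e)))
          ; image-mono = λ {e} {f} → place-mono (F.<-cmp e ε) (F.<-cmp f ε)
          ; tail-ε     = place-ε (F.<-cmp ε ε) (proj₂ (proj₂ (proj₂ (star ε))))
          ; center-new = v-new
          ; tail-new   = λ {e} e≢ε x eq → place-fresh e (F.<-cmp e ε) e≢ε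
              (x , subst (Joins G _ v) (sym eq) (joins-sym G (proj₂ (proj₂ (proj₂ (star e))))))
          }
          where
          star : ∀ e → InStar (level U₀ s) v i (place e (F.<-cmp e ε))
          star e = place-star e (F.<-cmp e ε)

    -- On each side of `e*` as many fresh edges are chosen as `H` has edges, which is enough for any
    -- position of `ε` in its star.
    central⇒starImage : Central (level U₀ s) v i e* → (∀ x → φ x ≢ v) → StarImage s u i ε φ
    central⇒starImage (below , above) =
      Around.starImage (choose (below? star? e*) below) (choose (above? star? e*) above)

  abstract

    star-image : ∀ s {u} → U (suc s) u → ∀ i ε φ → StarImage s u i ε φ
    star-image s {u} Uu i ε φ with usable-edge s u Uu i φ
    ... | e , (z , v , j , central) , new = central⇒starImage i ε (proj₁ Uu) z j central
      λ x eq → new (x , subst (Joins G e u) (sym eq) j)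

  -- All vertices of `H` get distinct provisional images in `U s`, so that every leaf has one before
  -- its star is embedded. They are the far ends of `h` edges at one center, which exist because
  -- `margin` edges precede a usable edge there.
  initial : ∀ {s} {R : Fin (size H) → Set} → (∀ e → ¬ R e) → ∃ (U (suc s)) → PartialEmbedding R s
  initial {s} empty (u , Uu) = record
    { φ           = φ
    ; ψ           = λ _ → e
    ; φ-injective = λ {x} {y} eq → mono⇒injective f-mono
        (edge-unique G (tail-joins x) (subst (λ w → Joins G (f y) w v) (sym eq) (tail-joins y)))
    ; φ-β         = λ e → proj₁ (proj₂ (proj₂ (f-star (β e))))
    ; ψ-zone      = λ {e} r → contradiction r (empty e)
    ; ψ-joins     = λ {e} r → contradiction r (empty e)
    ; ψ-monotone  = λ {e} r → contradiction r (empty e)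
    }
    where
    i₀ : Fin (size H)
    i₀ = F.fromℕ< nonempty
    parent : ∃ λ e → Usable (level U₀ s) u i₀ e × ¬ ∃ λ (_ : Fin h) → Joins G e u u
    -- Any zone will do, and nothing is placed yet, so the map to be avoided is a dummy.
    parent = usable-edge s u Uu i₀ (λ (_ : Fin h) → u)
    e = proj₁ parent
    v : Fin n
    v = proj₁ (proj₂ (proj₁ (proj₂ parent)))
    star? : Decidable (InStar (level U₀ s) v i₀)
    star? = inStar? (level U₀ s) v i₀
    chosen : ∃ λ (f : Fin h → Fin (size G)) →
               (∀ x → Below star? e (f x)) × (∀ {x y} → x F.< y → f x F.< f y)
    chosen = enum≤ (below? star? e)
      (≤-trans (m≤m+n h (size H)) (proj₁ (proj₂ (proj₂ (proj₂ (proj₁ (proj₂ parent)))))))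
    f = proj₁ chosen
    f-star : ∀ x → InStar (level U₀ s) v i₀ (f x)
    f-star x = proj₁ (proj₁ (proj₂ chosen) x)
    f-mono : ∀ {x y} → x F.< y → f x F.< f y
    f-mono = proj₂ (proj₂ chosen)
    φ : Fin h → Fin n
    φ x = proj₁ (proj₂ (f-star x))
    tail-joins : ∀ x → Joins G (f x) (φ x) v
    tail-joins x = proj₂ (proj₂ (proj₂ (f-star x)))

  module Extend {s} {R : Fin (size H) → Set} (closed : ∀ {e f} → α e ≡ α f → R e → R f)
    {ε} (ε∈R : R ε)
    (leafStar : ∀ e f → α e ≡ α ε → e ≢ ε → R f → α f ≢ α ε → β e ≢ β f)
    (old : PartialEmbedding (λ e → R e × α e ≢ α ε) (suc s)) where

    private
      module Old = PartialEmbedding old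

      open StarImage (star-image s (Old.φ-β ε) (label ε) ε Old.φ)

      tail-injective : ∀ {e f} → tail e ≡ tail f → e ≡ f
      tail-injective {e} {f} eq = mono⇒injective image-mono
        (edge-unique G (tail-joins e) (subst (λ w → Joins G (image f) w center) (sym eq) (tail-joins f)))

      -- The graph of the new vertex map. The leaves of the new star move to its tails, but `β ε`
      -- keeps its image by `tail-ε`. By the leaf star property no embedded edge of another star
      -- ends in a leaf that moves.
      data New : Fin h → Fin n → Set where
        hub  : New (α ε) center
        leaf : ∀ {e} → α e ≡ α ε → New (β e) (tail e)
        kept : ∀ {x} → x ≢ α ε → ¬ (∃ λ e → α e ≡ α ε × β e ≡ x) → New x (Old.φ x)

      new′ : ∀ x → Dec (x ≡ α ε) → Dec (∃ λ e → α e ≡ α ε × β e ≡ x) → ∃ (New x)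
      new′ x (yes refl) _                     = center , hub
      new′ x (no _)     (yes (_ , α≡ , refl)) = _ , leaf α≡
      new′ x (no x≢)    (no ¬leaf)            = _ , kept x≢ ¬leaf

      new : ∀ x → ∃ (New x)
      new x = new′ x (x F.≟ α ε) (any? λ e → (α e F.≟ α ε) ×-dec (β e F.≟ x))

      new-injective : ∀ {x y w} → New x w → New y w → x ≡ y
      new-injective p q = go p q refl
        where
        leaf-kept : ∀ {e x} → ¬ (∃ λ e → α e ≡ α ε × β e ≡ x) → tail e ≡ Old.φ x → β e ≡ x
        leaf-kept {e} {x} ¬leaf eq with e F.≟ ε
        ... | yes refl = Old.φ-injective (trans (sym tail-ε) eq)
        ... | no e≢ε   = contradiction (sym eq) (tail-new e≢ε x)
        go : ∀ {x y w w′} → New x w → New y w′ → w ≡ w′ → x ≡ y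
        go hub         hub          _  = refl
        go hub         (leaf {e} _) eq = contradiction (sym eq) (joins⇒≢ G (tail-joins e))
        go hub         (kept _ _)   eq = contradiction (sym eq) (center-new _)
        go (leaf {e} _) hub         eq = contradiction eq (joins⇒≢ G (tail-joins e))
        go (leaf _)    (leaf _)     eq = cong β (tail-injective eq)
        go (leaf _)    (kept _ ¬l)  eq = leaf-kept ¬l eq
        go (kept _ _)  hub          eq = contradiction eq (center-new _)
        go (kept _ ¬l) (leaf _)     eq = sym (leaf-kept ¬l (sym eq))
        go (kept _ _)  (kept _ _)   eq = Old.φ-injective eq

      φ′ : Fin h → Fin n
      φ′ x = proj₁ (new x)

      φ′-center : φ′ (α ε) ≡ center
      φ′-center = go (proj₂ (new (α ε))) refl
        where
        go : ∀ {x w} → New x w → x ≡ α ε → w ≡ center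
        go hub           _  = refl
        go (leaf {e} _)  eq = contradiction (sym eq) (disjoint ε e)
        go (kept x≢ _)   eq = contradiction eq x≢

      φ′-leaf : ∀ {e} → α e ≡ α ε → φ′ (β e) ≡ tail e
      φ′-leaf {e} α≡ = go (proj₂ (new (β e))) refl
        where
        go : ∀ {x w} → New x w → x ≡ β e → w ≡ tail e
        go hub            eq = contradiction eq (disjoint ε e)
        go (leaf α≡′)     eq = cong tail (β-injective (trans α≡′ (sym α≡)) eq)
        go (kept _ ¬leaf) eq = contradiction (e , α≡ , sym eq) ¬leaf

      φ′-α : ∀ {e} → α e ≢ α ε → φ′ (α e) ≡ Old.φ (α e)
      φ′-α {e} α≢ = go (proj₂ (new (α e))) refl
        where
        go : ∀ {x w} → New x w → x ≡ α e → w ≡ Old.φ (α e)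
        go hub          eq = contradiction (sym eq) α≢
        go (leaf {f} _) eq = contradiction (sym eq) (disjoint e f)
        go (kept _ _)   eq = cong Old.φ eq

      φ′-β : ∀ {e} → R e → α e ≢ α ε → φ′ (β e) ≡ Old.φ (β e)
      φ′-β {e} r α≢ = go (proj₂ (new (β e))) refl
        where
        go : ∀ {x w} → New x w → x ≡ β e → w ≡ Old.φ (β e)
        go hub               eq = contradiction eq (disjoint ε e)
        go (leaf {f} α≡)     eq with f F.≟ ε
        ... | yes refl = trans tail-ε (cong Old.φ eq)
        ... | no f≢ε   = contradiction eq (leafStar f e α≡ f≢ε r α≢)
        go (kept _ _)        eq = cong Old.φ eq

      -- Unmoved images lie in `U (suc s)`, but the tails only in `U s`; this is the level lost.
      φ′-β-U : ∀ e → U s (φ′ (β e))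
      φ′-β-U e = go (proj₂ (new (β e))) refl
        where
        go : ∀ {x w} → New x w → x ≡ β e → U s w
        go hub          eq = contradiction eq (disjoint ε e)
        go (leaf {f} _) eq = tail-U f
        go (kept _ _)   eq = proj₁ (subst (U (suc s)) (cong Old.φ (sym eq)) (Old.φ-β e))

      choose-ψ : ∀ e → Dec (α e ≡ α ε) → Fin (size G)
      choose-ψ e (yes _) = image e
      choose-ψ e (no _)  = Old.ψ e

      ψ′ : Fin (size H) → Fin (size G)
      ψ′ e = choose-ψ e (α e F.≟ α ε)

      ψ′-zone : ∀ {e} → R e → Zone (label e) (ψ′ e)
      ψ′-zone {e} r = go (α e F.≟ α ε)
        where
        go : ∀ d → Zone (label e) (choose-ψ e d)
        go (yes α≡) = subst (λ i → Zone i (image e)) (label-cong (sym α≡)) (zone e)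
        go (no α≢)  = Old.ψ-zone (r , α≢)

      ψ′-joins : ∀ {e} → R e → Joins G (ψ′ e) (φ′ (α e)) (φ′ (β e))
      ψ′-joins {e} r = go (α e F.≟ α ε)
        where
        go : ∀ d → Joins G (choose-ψ e d) (φ′ (α e)) (φ′ (β e))
        go (yes α≡) = subst₂ (Joins G (image e))
          (sym (trans (cong φ′ α≡) φ′-center)) (sym (φ′-leaf α≡)) (joins-sym G (tail-joins e))
        go (no α≢)  = subst₂ (Joins G (Old.ψ e))
          (sym (φ′-α α≢)) (sym (φ′-β r α≢)) (Old.ψ-joins (r , α≢))

      ψ′-monotone : ∀ {e f} → R e → R f → α e ≡ α f → e F.< f → ψ′ e F.< ψ′ f
      ψ′-monotone {e} {f} r t eq e<f = go (α e F.≟ α ε) (α f F.≟ α ε)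
        where
        go : ∀ d d′ → choose-ψ e d F.< choose-ψ f d′
        go (yes _)  (yes _)  = image-mono e<f
        go (no α≢)  (no α≢′) = Old.ψ-monotone (r , α≢) (t , α≢′) eq e<f
        go (yes α≡) (no α≢)  = contradiction (trans (sym eq) α≡) α≢
        go (no α≢)  (yes α≡) = contradiction (trans eq α≡) α≢

    extend : PartialEmbedding R s
    extend = record
      { φ           = φ′
      ; ψ           = ψ′
      ; φ-injective = λ {x} {y} eq →
          new-injective (proj₂ (new x)) (subst (New y) (sym eq) (proj₂ (new y)))
      ; φ-β         = φ′-β-U
      ; ψ-zone      = ψ′-zone
      ; ψ-joins     = ψ′-joins
      ; ψ-monotone  = ψ′-monotone
      }

  -- Induction on a bound `k` for the number of edges in `R`: a leaf star is removed, the rest is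
  -- embedded one level higher, and the star is attached again at the image of `β ε`. This takes at
  -- most one level per edge, and one more for `initial`.
  partialEmbedding : ∀ k s {R} (R? : Decidable R) → (∀ {e f} → α e ≡ α f → R e → R f) →
                     count R? ≤ k → ∃ (U (suc s + k)) → PartialEmbedding R s
  partialEmbedding k s R? closed count≤ top with any? R?
  partialEmbedding k s R? closed count≤ (u , Uu) | no ¬R =
    initial (λ e r → ¬R (e , r)) (u , level-antitone U₀ (suc s) k {u} Uu)
  partialEmbedding zero s R? closed count≤ top | yes (e , r) =
    contradiction (∃⇒count>0 R? r) (≤⇒≯ count≤)
  partialEmbedding (suc k) s {R} R? closed count≤ (u , Uu) | yes R≢∅
    with ε , r , leaf ← leaf-star forest R? closed R≢∅ =
    Extend.extend closed r leaf
      (partialEmbedding k (suc s) rest?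
        (λ eq (t , α≢) → closed eq t , α≢ ∘ trans eq)
        (≤-pred (≤-trans (count-mono-< rest? R? proj₁ (λ (_ , α≢) → α≢ refl) r) count≤))
        (u , subst (λ r → U r u) (cong suc (+-suc s k)) Uu))
    where
    rest? : Decidable (λ e → R e × α e ≢ α ε)
    rest? e = R? e ×-dec ¬? (α e F.≟ α ε)

  private
    all-edges? : Decidable (λ (_ : Fin (size H)) → ⊤)
    all-edges? _ = yes _

  -- Edges in different stars are ordered correctly because the zones are, through `label-mono`;
  -- inside a star the order is part of the partial embedding.
  contains : ∃ (U (suc (size H))) → Contains G H
  contains top = E.φ , E.ψ , mkEmbedding E.φ-injective monotone joins-ψ
    where
    module E = PartialEmbedding
      (partialEmbedding (size H) 0 {λ _ → ⊤} all-edges? (λ _ r → r)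
         (count-≤-injection all-edges? (λ e _ → e) (λ _ _ eq → eq)) top)
    monotone : ∀ {e f} → e F.< f → E.ψ e F.< E.ψ f
    monotone {e} {f} e<f with α e F.≟ α f
    ... | yes eq = E.ψ-monotone _ _ eq e<f
    ... | no α≢  = zone-mono (label-mono α≢ e<f) (E.ψ-zone _) (E.ψ-zone _)
    joins-ψ : ∀ {e x y} → Joins H e x y → Joins G (E.ψ e) (E.φ x) (E.φ y)
    joins-ψ {e} j with joins-ends H (joins e) j
    ... | inj₁ (refl , refl) = E.ψ-joins _
    ... | inj₂ (refl , refl) = joins-sym G (E.ψ-joins _)

  -- As `H` is avoided, the last level is empty, so all of `U₀` has been discarded on the way.
  count-U₀ : ¬ Contains G H → ∀ {g} → (∀ {u} → proj₁ U₀ u → ∀ i → h + g ≤ degree i u) →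
             g * ∣ U₀ ∣ ≤ suc (size H) * (size H * (2 * margin * count V?))
  count-U₀ avoids {g} deg≥ = begin
    g * ∣ U₀ ∣                                  ≤⟨ level-loss U₀ deg≥ (suc (size H)) ⟩
    g * ∣ level U₀ (suc (size H)) ∣ + X         ≤⟨ +-monoˡ-≤ X (*-monoʳ-≤ g
      (≮⇒≥ λ 0< → avoids (contains (count>0⇒∃ (proj₂ (level U₀ (suc (size H)))) 0<)))) ⟩
    g * 0 + X                                   ≡⟨ cong (_+ X) (*-zeroʳ g) ⟩
    X                                           ∎
    where
    open ≤-Reasoning
    X = suc (size H) * (size H * (2 * margin * count V?))

-- Vertices with many edges in many intervals

module _ {n k} (G : EdgeOrderedGraph n) (f : Fin k → Fin (size G))
         (f-mono : ∀ {e e′} → e F.< e′ → f e F.< f e′) where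

  subgraph : EdgeOrderedGraph n
  subgraph = mkGraph k (edge G ∘ f) (sorted G ∘ f) (mono⇒injective f-mono ∘ edge-injective G)

  contains-subgraph : ∀ {h} {H : EdgeOrderedGraph h} → Contains subgraph H → Contains G H
  contains-subgraph (φ , ψ , mkEmbedding inj mono joins) = φ , f ∘ ψ , mkEmbedding inj (f-mono ∘ mono) joins

module Degrees {n t} (G : EdgeOrderedGraph n) (J : Fin (size G) → Fin t) where

  incident? : ∀ v j → Decidable (λ e → J e ≡ j × ∃ (Joins G e v))
  incident? v j e = (J e F.≟ j) ×-dec any? (joins? G e v)

  degree : Fin n → Fin t → ℕ
  degree v j = count (incident? v j)

  -- Handshake count: each edge lies in one class and has two ends.
  sum-degree : sum (λ j → sum (λ v → degree v j)) ≤ size G * 2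
  sum-degree = begin
    sum (λ j → sum (λ v → degree v j))
      ≡⟨ ∑-comm (λ j v → degree v j) ⟩
    sum (λ v → sum (λ j → degree v j))
      ≡⟨ sum-cong-≗ (λ v → ∑-comm (λ j e → ⟦ incident? v j e ⟧)) ⟩
    sum (λ v → sum (λ e → count (λ j → incident? v j e)))
      ≡⟨ ∑-comm (λ v e → count (λ j → incident? v j e)) ⟩
    sum (λ e → sum (λ v → count (λ j → incident? v j e)))
      ≤⟨ sum-≤-const two-ends ⟩
    size G * 2  ∎
    where
    open ≤-Reasoning
    two-ends : ∀ e → sum (λ v → count (λ j → incident? v j e)) ≤ 2
    two-ends e = begin
      sum (λ v → count (λ j → incident? v j e))
        ≤⟨ sum-mono-≤ one-class ⟩
      count (λ v → any? (joins? G e v))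
        ≤⟨ count-∪ (λ v → any? (joins? G e v)) (F._≟ proj₁ (edge G e)) (F._≟ proj₂ (edge G e)) ends ⟩
      count (F._≟ proj₁ (edge G e)) + count (F._≟ proj₂ (edge G e))
        ≤⟨ +-mono-≤ (count≤1 (F._≟ proj₁ (edge G e)) λ p q → trans p (sym q))
                    (count≤1 (F._≟ proj₂ (edge G e)) λ p q → trans p (sym q)) ⟩
      2 ∎
      where
      ends : ∀ {v} → ∃ (Joins G e v) → v ≡ proj₁ (edge G e) ⊎ v ≡ proj₂ (edge G e)
      ends (_ , inj₁ eq) = inj₁ (sym (cong proj₁ eq))
      ends (_ , inj₂ eq) = inj₂ (sym (cong proj₂ eq))
      one-class : ∀ v → count (λ j → incident? v j e) ≤ ⟦ any? (joins? G e v) ⟧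
      one-class v with any? (joins? G e v)
      ... | yes j = count≤1 (λ i → (J e F.≟ i) ×-dec yes j) λ (p , _) (q , _) → trans (sym p) q
      ... | no ¬j = ≮⇒≥ λ 0< →
        ¬j (proj₂ (proj₂ (count>0⇒∃ (λ i → (J e F.≟ i) ×-dec no ¬j) 0<)))

module _ {h} (H : EdgeOrderedGraph h) (nonempty : 0 < size H)
         (forest : IsForest H) (stars : StarDecomposition H) where

  private
    q = size H

  loss : ℕ
  loss = suc q * (q * (2 * (h + q)))

  module RichVertices {n t} (G : EdgeOrderedGraph n) (avoids : Avoids G H)
    {V : Fin n → Set} (V? : Decidable V) (ends-V : ∀ {e u v} → Joins G e u v → V u)
    (J : Fin (size G) → Fin t) (J-mono : ∀ {e f} → J e F.< J f → e F.< f) (g : ℕ) where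

    open Degrees G J

    Rich : Fin n → Set
    Rich u = q ≤ count (λ j → h + g ≤? degree u j)

    rich? : Decidable Rich
    rich? u = q ≤? count (λ j → h + g ≤? degree u j)

    Increasing : (Fin q → Fin t) → Set
    Increasing S = ∀ i j → i F.< j → S i F.< S j

    increasing? : Decidable Increasing
    increasing? S = all? λ i → all? λ j → (i F.<? j) →-dec (S i F.<? S j)

    -- Monotonicity of `S` is part of the condition, so that the union bound in `count-rich` may run
    -- over all `t ^ q` maps.
    RichAlong : (Fin q → Fin t) → Fin n → Set
    RichAlong S u = Increasing S × ∀ i → h + g ≤ degree u (S i)

    richAlong? : ∀ S → Decidable (RichAlong S)
    richAlong? S u = increasing? S ×-dec all? λ i → h + g ≤? degree u (S i)

    -- For increasing `S` the classes `S i` are the zones into which the stars are embedded; for any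
    -- other `S` the set is empty.
    count-richAlong : ∀ S → g * count (richAlong? S) ≤ loss * count V?
    count-richAlong S with increasing? S
    ... | yes inc = ≤-trans
      (Embedding.count-U₀ G H nonempty forest stars V? ends-V
        {Zone = λ i e → J e ≡ S i} (λ i e → J e F.≟ S i)
        (λ {i} {j} i<j p q → J-mono (subst₂ F._<_ (sym p) (sym q) (inc i j i<j)))
        (RichAlong S , λ u → yes inc ×-dec all? λ i → h + g ≤? degree u (S i)) avoids proj₂)
      (≤-reflexive (reassoc (suc q) q (2 * (h + q)) (count V?)))
      where
      reassoc : ∀ a b c d → a * (b * (c * d)) ≡ a * (b * c) * d
      reassoc = solve-∀
    ... | no ¬inc = ≤-trans (*-monoʳ-≤ g {y = 0} (≮⇒≥ λ 0< →
        ¬inc (proj₁ (proj₂ (count>0⇒∃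
          (λ u → no ¬inc ×-dec all? λ i → h + g ≤? degree u (S i)) 0<)))))
      (≤-trans (≤-reflexive (*-zeroʳ g)) z≤n)

    count-rich : g * count rich? ≤ t ^ q * (loss * count V?)
    count-rich = begin
      g * count rich?
        ≤⟨ *-monoʳ-≤ g (sum-mono-≤ λ u → ⟦⟧≤ (rich? u) (some-S u)) ⟩
      g * sum (λ u → sum (λ s → ⟦ along? s u ⟧))
        ≡⟨ cong (g *_) (∑-comm (λ u s → ⟦ along? s u ⟧)) ⟩
      g * sum (λ s → count (along? s))
        ≡⟨ *-distribˡ-sum g (λ s → count (along? s)) ⟩
      sum (λ s → g * count (along? s))
        ≤⟨ sum-≤-const (λ s → count-richAlong (finToFun s)) ⟩
      t ^ q * (loss * count V?) ∎
      where
      open ≤-Reasoning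
      along? : ∀ (s : Fin (t ^ q)) → Decidable (RichAlong (finToFun s))
      along? s = richAlong? (finToFun s)
      some-S : ∀ u → Rich u → 1 ≤ sum (λ s → ⟦ along? s u ⟧)
      some-S u rich with S , large , mono ← enum≤ (λ j → h + g ≤? degree u j) rich = ≤-trans
        (⟦⟧-true (along? s u)
          ( (λ i j i<j → subst₂ F._<_ (sym (eq i)) (sym (eq j)) (mono i<j))
          , (λ i → subst (λ j → h + g ≤ degree u j) (sym (eq i)) (large i)) ))
        (term≤sum (λ s → ⟦ along? s u ⟧) s)
        where
        s : Fin (t ^ q)
        s = funToFin S
        eq : ∀ i → finToFun s i ≡ S i
        eq = finToFun-funToFin S

-- Heavy and light incidences

module _ {h} (H : EdgeOrderedGraph h) where

  -- The induction hypothesis. The ambient `n` stays fixed and a smaller vertex set is expressed by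
  -- `V`, which avoids relabelling vertices.
  Bound : ℕ → ℕ → ℕ → Set₁
  Bound n D N = ∀ (G : EdgeOrderedGraph n) → Avoids G H →
                ∀ {V : Fin n → Set} (V? : Decidable V) → (∀ {e u v} → Joins G e u v → V u) →
                count V? < N → size G ≤ D * count V?

  module Split {n t D N} (bound : Bound n D N) (G : EdgeOrderedGraph n) (avoids : Avoids G H)
    {V : Fin n → Set} (V? : Decidable V) (ends-V : ∀ {e u v} → Joins G e u v → V u)
    (J : Fin (size G) → Fin t) (class-size : ∀ j → count (λ e → J e F.≟ j) ≤ D * N) where

    open Degrees G J

    Heavy : Fin n → Fin t → Set
    Heavy v j = 8 * D ≤ degree v j

    heavy? : ∀ v j → Dec (Heavy v j)
    heavy? v j = 8 * D ≤? degree v j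

    HeavyEdge : Fin (size G) → Set
    HeavyEdge e = ∀ v → ∃ (Joins G e v) → Heavy v (J e)

    heavyEdge? : Decidable HeavyEdge
    heavyEdge? e = all? λ v → any? (joins? G e v) →-dec heavy? v (J e)

    private
      part? : ∀ j → Decidable (λ e → J e ≡ j × HeavyEdge e)
      part? j e = (J e F.≟ j) ×-dec heavyEdge? e

      -- The heavy vertices of interval `j` play the role of `V`. If there are fewer than `N` of
      -- them, the induction hypothesis applies; otherwise the length of the interval is already
      -- small enough.
      count-part : ∀ j → count (part? j) ≤ D * count (λ v → heavy? v j)
      count-part j with count (λ v → heavy? v j) <? N
      ... | yes small = bound part (avoids ∘ contains-subgraph G f f-mono)
                          (λ v → heavy? v j) ends small
        where
        f : Fin (count (part? j)) → Fin (size G)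
        f i = proj₁ (enum (part? j) i)
        f-mono : ∀ {i i′} → i F.< i′ → f i F.< f i′
        f-mono = enum-mono (part? j)
        part : EdgeOrderedGraph n
        part = subgraph G f f-mono
        ends : ∀ {i u v} → Joins part i u v → Heavy u j
        ends {i} {u} {v} k = let J≡ , heavy = proj₂ (enum (part? j) i)
                             in subst (Heavy u) J≡ (heavy u (v , k))
      ... | no large = begin
        count (part? j)                    ≤⟨ count-mono (part? j) (λ e → J e F.≟ j) proj₁ ⟩
        count (λ e → J e F.≟ j)            ≤⟨ class-size j ⟩
        D * N                              ≤⟨ *-monoʳ-≤ D (≮⇒≥ large) ⟩
        D * count (λ v → heavy? v j)       ∎
        where open ≤-Reasoning

    -- Each heavy incidence accounts for `8 * D` of the total degree, which is at most twice the
    -- size. So the heavy edges make up at most 2/8 of all edges.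
    count-heavyEdge : count heavyEdge? * 4 ≤ size G
    count-heavyEdge = *-cancelʳ-≤ _ _ 2 (begin
      count heavyEdge? * 4 * 2
        ≡⟨ trans (*-assoc (count heavyEdge?) 4 2) (*-comm (count heavyEdge?) 8) ⟩
      8 * count heavyEdge?
        ≤⟨ *-monoʳ-≤ 8 (sum-mono-≤ λ e → ⟦⟧≤ (heavyEdge? e) λ k →
             ≤-trans (⟦⟧-true (part? (J e) e) (refl , k)) (term≤sum (λ j → ⟦ part? j e ⟧) (J e))) ⟩
      8 * sum (λ e → sum (λ j → ⟦ part? j e ⟧))
        ≡⟨ cong (8 *_) (∑-comm (λ e j → ⟦ part? j e ⟧)) ⟩
      8 * sum (λ j → count (part? j))
        ≤⟨ *-monoʳ-≤ 8 (sum-mono-≤ count-part) ⟩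
      8 * sum (λ j → D * count (λ v → heavy? v j))
        ≡⟨ *-distribˡ-sum 8 (λ j → D * count (λ v → heavy? v j)) ⟩
      sum (λ j → 8 * (D * count (λ v → heavy? v j)))
        ≤⟨ sum-mono-≤ heavy-degrees ⟩
      sum (λ j → sum (λ v → degree v j))
        ≤⟨ sum-degree ⟩
      size G * 2 ∎)
      where
      open ≤-Reasoning
      heavy-degrees : ∀ j → 8 * (D * count (λ v → heavy? v j)) ≤ sum (λ v → degree v j)
      heavy-degrees j = begin
        8 * (D * count (λ v → heavy? v j))     ≡⟨ *-assoc 8 D (count (λ v → heavy? v j)) ⟨
        8 * D * count (λ v → heavy? v j)       ≡⟨ *-distribˡ-sum (8 * D) (λ v → ⟦ heavy? v j ⟧) ⟩
        sum (λ v → 8 * D * ⟦ heavy? v j ⟧)     ≤⟨ sum-mono-≤ (λ v → *⟦⟧≤ (heavy? v j) id) ⟩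
        sum (λ v → degree v j)                 ∎

    private
      light? : ∀ u j → Decidable (λ e → (J e ≡ j × ∃ (Joins G e u)) × ¬ Heavy u j)
      light? u j e = incident? u j e ×-dec ¬? (heavy? u j)

      light : Fin n → Fin t → ℕ
      light u j = count (light? u j)

      light≤degree : ∀ u j → light u j ≤ degree u j
      light≤degree u j = count-mono (light? u j) (incident? u j) proj₁

      light≤8D : ∀ u j → light u j ≤ 8 * D
      light≤8D u j with heavy? u j
      ... | yes heavy = ≤-trans
        (≮⇒≥ {0} λ 0< → proj₂ (proj₂ (count>0⇒∃ (λ e → incident? u j e ×-dec ¬? (yes heavy)) 0<)) heavy)
        z≤n
      ... | no ¬heavy = ≤-trans
        (count-mono (λ e → incident? u j e ×-dec ¬? (no ¬heavy)) (incident? u j) proj₁)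
        (<⇒≤ (≰⇒> ¬heavy))

      -- An edge that is not heavy is counted at an end that is light in its interval.
      size≤ : size G ≤ count heavyEdge? + sum (λ u → sum (light u))
      size≤ = begin
        size G
          ≡⟨ trans (sym (*-identityʳ (size G))) (sym (sum-const (size G) 1)) ⟩
        sum (λ (e : Fin (size G)) → 1)
          ≤⟨ sum-mono-≤ split ⟩
        sum (λ e → ⟦ heavyEdge? e ⟧ + sum (λ u → sum (λ j → ⟦ light? u j e ⟧)))
          ≡⟨ ∑-distrib-+ (λ e → ⟦ heavyEdge? e ⟧) (λ e → sum (λ u → sum (λ j → ⟦ light? u j e ⟧))) ⟩
        count heavyEdge? + sum (λ e → sum (λ u → sum (λ j → ⟦ light? u j e ⟧)))
          ≡⟨ cong (count heavyEdge? +_) (∑-comm (λ e u → sum (λ j → ⟦ light? u j e ⟧))) ⟩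
        count heavyEdge? + sum (λ u → sum (λ e → sum (λ j → ⟦ light? u j e ⟧)))
          ≡⟨ cong (count heavyEdge? +_) (sum-cong-≗ λ u → ∑-comm (λ e j → ⟦ light? u j e ⟧)) ⟩
        count heavyEdge? + sum (λ u → sum (light u)) ∎
        where
        open ≤-Reasoning
        split : ∀ e → 1 ≤ ⟦ heavyEdge? e ⟧ + sum (λ u → sum (λ j → ⟦ light? u j e ⟧))
        split e = go (any? λ u → any? (joins? G e u) ×-dec ¬? (heavy? u (J e)))
          where
          go : Dec (∃ λ u → ∃ (Joins G e u) × ¬ Heavy u (J e)) →
               1 ≤ ⟦ heavyEdge? e ⟧ + sum (λ u → sum (λ j → ⟦ light? u j e ⟧))
          go (yes (u , k , ¬heavy)) = ≤-trans
            (≤-trans (⟦⟧-true (light? u (J e) e) ((refl , k) , ¬heavy))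
              (≤-trans (term≤sum (λ j → ⟦ light? u j e ⟧) (J e))
                       (term≤sum (λ u → sum (λ j → ⟦ light? u j e ⟧)) u)))
            (m≤n+m _ _)
          go (no all-heavy) = ≤-trans
            (⟦⟧-true (heavyEdge? e) λ v k →
              decidable-stable (heavy? v (J e)) λ ¬heavy → all-heavy (v , k , ¬heavy))
            (m≤m+n _ _)

    module _ (q c : ℕ) where

      Rich : Fin n → Set
      Rich u = q ≤ count (λ j → c ≤? degree u j)

      private
        rich? : Decidable Rich
        rich? u = q ≤? count (λ j → c ≤? degree u j)

        -- Fewer than `q` intervals contribute up to `8 * D` each, and the others fewer than `c`
        -- each.
        light-few : ∀ u → ¬ Rich u → sum (light u) ≤ 8 * D * q + t * c
        light-few u poor = begin
          sum (light u)
            ≤⟨ sum-mono-≤ per-class ⟩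
          sum (λ j → 8 * D * ⟦ c ≤? degree u j ⟧ + c)
            ≡⟨ ∑-distrib-+ (λ j → 8 * D * ⟦ c ≤? degree u j ⟧) (λ _ → c) ⟩
          sum (λ j → 8 * D * ⟦ c ≤? degree u j ⟧) + sum {t} (λ _ → c)
            ≡⟨ cong₂ _+_ (sym (*-distribˡ-sum (8 * D) (λ j → ⟦ c ≤? degree u j ⟧))) (sum-const t c) ⟩
          8 * D * count (λ j → c ≤? degree u j) + t * c
            ≤⟨ +-monoˡ-≤ (t * c) (*-monoʳ-≤ (8 * D) (<⇒≤ (≰⇒> poor))) ⟩
          8 * D * q + t * c ∎
          where
          open ≤-Reasoning
          per-class : ∀ j → light u j ≤ 8 * D * ⟦ c ≤? degree u j ⟧ + c
          per-class j with c ≤? degree u j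
          ... | yes _ = ≤-trans (light≤8D u j) (≤-trans (m≤m*n (8 * D) 1) (m≤m+n _ c))
          ... | no ¬c = ≤-trans (light≤degree u j) (≤-trans (<⇒≤ (≰⇒> ¬c)) (m≤n+m c _))

        light-outside : ∀ u → ¬ V u → sum (light u) ≤ 0
        light-outside u ¬v = ≤-trans
          (sum-≤-const λ j → ≮⇒≥ {0} λ 0< →
            let _ , (_ , _ , k) , _ = count>0⇒∃ (light? u j) 0< in ¬v (ends-V k))
          (≤-reflexive (*-zeroʳ t))

        light-total : ∀ u → sum (light u) ≤ (8 * D * q + t * c) * ⟦ V? u ⟧ + t * (8 * D) * ⟦ rich? u ⟧
        light-total u with V? u | rich? u
        ... | no ¬v | _ = ≤-trans (light-outside u ¬v) z≤n
        ... | yes _ | yes _ = ≤-trans (sum-≤-const (light≤8D u)) (≤-trans (m≤m*n (t * (8 * D)) 1) (m≤n+m _ _))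
        ... | yes _ | no poor = ≤-trans (light-few u poor) (≤-trans (m≤m*n (8 * D * q + t * c) 1) (m≤m+n _ _))

      -- After multiplication by 4 the heavy edges amount to at most one copy of `size G`, which is
      -- cancelled.
      size-bound : size G * 3 ≤ ((8 * D * q + t * c) * count V? +
                                 t * (8 * D) * count (λ u → q ≤? count (λ j → c ≤? degree u j))) * 4
      size-bound = +-cancelˡ-≤ (size G) _ _ (begin
        size G + size G * 3
          ≡⟨ *-suc (size G) 3 ⟨
        size G * 4
          ≤⟨ *-monoˡ-≤ 4 size≤ ⟩
        (count heavyEdge? + sum (λ u → sum (light u))) * 4
          ≡⟨ *-distribʳ-+ 4 (count heavyEdge?) _ ⟩
        count heavyEdge? * 4 + sum (λ u → sum (light u)) * 4
          ≤⟨ +-mono-≤ count-heavyEdge (*-monoˡ-≤ 4 (sum-mono-≤ light-total)) ⟩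
        size G + sum (λ u → A * ⟦ V? u ⟧ + B * ⟦ rich? u ⟧) * 4
          ≡⟨ cong (λ x → size G + x * 4) (∑-distrib-+ (λ u → A * ⟦ V? u ⟧) (λ u → B * ⟦ rich? u ⟧)) ⟩
        size G + (sum (λ u → A * ⟦ V? u ⟧) + sum (λ u → B * ⟦ rich? u ⟧)) * 4
          ≡⟨ cong₂ (λ x y → size G + (x + y) * 4) (sym (*-distribˡ-sum A (λ u → ⟦ V? u ⟧)))
                                                  (sym (*-distribˡ-sum B (λ u → ⟦ rich? u ⟧))) ⟩
        size G + (A * count V? + B * count rich?) * 4 ∎)
        where
        open ≤-Reasoning
        A = 8 * D * q + t * c
        B = t * (8 * D)

-- Density increment and growth of the bound

-- Growth `2 ^ O(T)`; the condition `1 ≤ T` lets constant factors be absorbed in the exponent.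
Moderate : (ℕ → ℕ) → Set
Moderate f = ∃ λ C → ∀ T → 1 ≤ T → f T ≤ 2 ^ (C * T)

n<2^n : ∀ n → n < 2 ^ n
n<2^n zero    = z<s
n<2^n (suc n) = +-mono-≤ (m^n>0 2 n) (≤-trans (n<2^n n) (≤-reflexive (sym (+-identityʳ (2 ^ n)))))

moderate-const : ∀ a → Moderate (λ _ → a)
moderate-const a = a , λ { (suc T) _ → ≤-trans (<⇒≤ (n<2^n a)) (^-monoʳ-≤ 2 (m≤m*n a (suc T))) }

moderate-* : ∀ {f g} → Moderate f → Moderate g → Moderate (λ T → f T * g T)
moderate-* {f} {g} (C , f≤) (D , g≤) = C + D , λ T 1≤T → begin
  f T * g T                  ≤⟨ *-mono-≤ (f≤ T 1≤T) (g≤ T 1≤T) ⟩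
  2 ^ (C * T) * 2 ^ (D * T)  ≡⟨ ^-distribˡ-+-* 2 (C * T) (D * T) ⟨
  2 ^ (C * T + D * T)        ≡⟨ cong (2 ^_) (*-distribʳ-+ T C D) ⟨
  2 ^ ((C + D) * T)          ∎
  where open ≤-Reasoning

moderate-+ : ∀ {f g} → Moderate f → Moderate g → Moderate (λ T → f T + g T)
moderate-+ {f} {g} (C , f≤) (D , g≤) = suc (C + D) , λ T 1≤T → begin
  f T + g T                              ≤⟨ +-mono-≤ (f≤ T 1≤T) (g≤ T 1≤T) ⟩
  2 ^ (C * T) + 2 ^ (D * T)
    ≤⟨ +-mono-≤ (^-monoʳ-≤ 2 (*-monoˡ-≤ T (m≤m+n C D))) (^-monoʳ-≤ 2 (*-monoˡ-≤ T (m≤n+m D C))) ⟩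
  2 ^ ((C + D) * T) + 2 ^ ((C + D) * T)  ≡⟨ cong (2 ^ ((C + D) * T) +_) (+-identityʳ _) ⟨
  2 ^ (1 + (C + D) * T)                  ≤⟨ ^-monoʳ-≤ 2 (+-monoˡ-≤ ((C + D) * T) 1≤T) ⟩
  2 ^ (suc (C + D) * T)                  ∎
  where open ≤-Reasoning

moderate-^ : ∀ {f} k → Moderate f → Moderate (λ T → f T ^ k)
moderate-^ zero    _ = moderate-const 1
moderate-^ (suc k) m = moderate-* m (moderate-^ k m)

moderate-exp : ∀ a → Moderate (λ T → a ^ T)
moderate-exp a = a , λ T _ → ≤-trans (^-monoˡ-≤ T (<⇒≤ (n<2^n a))) (≤-reflexive (^-*-assoc 2 a T))

-- Cutting the edge-order into intervals

module _ {n : ℕ} (G : EdgeOrderedGraph n) {w t : ℕ} .{{_ : NonZero w}} (size≤ : size G ≤ t * w) where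

  private
    quotient< : ∀ (e : Fin (size G)) → toℕ e / w < t
    quotient< e = m<n*o⇒m/o<n {toℕ e} {t} {w} (≤-trans (F.toℕ<n e) size≤)

  class : Fin (size G) → Fin t
  class e = fromℕ< (quotient< e)

  toℕ-class : ∀ e → toℕ (class e) ≡ toℕ e / w
  toℕ-class e = F.toℕ-fromℕ< (quotient< e)

  class-mono : ∀ {e f} → class e F.< class f → e F.< f
  class-mono {e} {f} lt = ≰⇒> λ f≤e → <⇒≱
    (subst₂ _<_ (toℕ-class e) (toℕ-class f) lt) (/-monoˡ-≤ w f≤e)

  class-size : ∀ j → count (λ e → class e F.≟ j) ≤ w
  class-size j = count-≤-interval (λ e → class e F.≟ j) toℕ (toℕ j * w) (λ _ _ → F.toℕ-injective)
    λ { {e} refl → ≤-trans (*-monoˡ-≤ w (≤-reflexive (toℕ-class e))) (m/n*n≤m (toℕ e) w)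
      , (begin-strict
          toℕ e                           ≡⟨ m≡m%n+[m/n]*n (toℕ e) w ⟩
          toℕ e % w + toℕ e / w * w       <⟨ +-monoˡ-< (toℕ e / w * w) (m%n<n (toℕ e) w) ⟩
          w + toℕ e / w * w               ≡⟨ +-comm w _ ⟩
          toℕ e / w * w + w               ≡⟨ cong (λ x → x * w + w) (toℕ-class e) ⟨
          toℕ (class e) * w + w           ∎) }
    where open ≤-Reasoning

-- This fixes the factor `16 * q + 4`: the terms for poor vertices cost `(32 * q + 4) * D * v` and
-- those for rich ones `8 * D * v`, while three times the factor is `48 * q + 12`.
edge-budget : ∀ q {D D₀ t v r} → D₀ ≤ D → 4 * t * r ≤ v →
              ((8 * D * q + D₀) * v + t * (8 * D) * r) * 4 ≤ (16 * q + 4) * D * v * 3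
edge-budget q {D} {D₀} {t} {v} {r} D₀≤D few = begin
  ((8 * D * q + D₀) * v + t * (8 * D) * r) * 4
    ≤⟨ *-monoˡ-≤ 4 (+-monoˡ-≤ (t * (8 * D) * r) (*-monoˡ-≤ v (+-monoʳ-≤ (8 * D * q) D₀≤D))) ⟩
  ((8 * D * q + D) * v + t * (8 * D) * r) * 4
    ≡⟨ regroup D q v t r ⟩
  (32 * q + 4) * D * v + 8 * D * (4 * t * r)
    ≤⟨ +-monoʳ-≤ ((32 * q + 4) * D * v) (*-monoʳ-≤ (8 * D) few) ⟩
  (32 * q + 4) * D * v + 8 * D * v
    ≤⟨ m≤m+n _ (16 * q * D * v) ⟩
  (32 * q + 4) * D * v + 8 * D * v + 16 * q * D * v
    ≡⟨ collect D q v ⟩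
  (16 * q + 4) * D * v * 3 ∎
  where
  open ≤-Reasoning
  regroup : ∀ D q v t r → ((8 * D * q + D) * v + t * (8 * D) * r) * 4 ≡
                          (32 * q + 4) * D * v + 8 * D * (4 * t * r)
  regroup = solve-∀
  collect : ∀ D q v → (32 * q + 4) * D * v + 8 * D * v + 16 * q * D * v ≡ (16 * q + 4) * D * v * 3
  collect = solve-∀

-- Iterating the density increment

module Iteration {h} (H : EdgeOrderedGraph h) (nonempty : 0 < size H)
  (forest : IsForest H) (stars : StarDecomposition H) where

  q K : ℕ
  q = size H
  K = 16 * q + 4

  private
    ℓ : ℕ
    ℓ = loss H nonempty forest stars

    instance
      q≢0 : NonZero q
      q≢0 = >-nonZero nonempty
      h+q≢0 : NonZero (h + q)
      h+q≢0 = >-nonZero (≤-trans nonempty (m≤n+m q h))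
      ℓ≢0 : NonZero ℓ
      ℓ≢0 = m*n≢0 (suc q) (q * (2 * (h + q))) {{_}} {{m*n≢0 q (2 * (h + q)) {{q≢0}} {{m*n≢0 2 (h + q)}}}}
      K≢0 : NonZero K
      K≢0 = >-nonZero (≤-trans (s≤s z≤n) (m≤n+m 4 (16 * q)))

  module _ (T : ℕ) where

    -- The value of `t` lets intervals of length `D * N` cover all edges considered in one step. By
    -- `count-rich`, `g` leaves at most `v / (4 * t)` rich vertices, and `D₀` pays for up to `t`
    -- intervals with fewer than `h + g` edges at a vertex.
    t g D₀ : ℕ
    t  = 2 ^ T * K
    g  = 4 * t * (t ^ q * ℓ)
    D₀ = t * (h + g)

    private
      instance
        2^T≢0 : NonZero (2 ^ T)
        2^T≢0 = m^n≢0 2 T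
        t≢0 : NonZero t
        t≢0 = m*n≢0 (2 ^ T) K
        t^q≢0 : NonZero (t ^ q)
        t^q≢0 = m^n≢0 t q
        t^qℓ≢0 : NonZero (t ^ q * ℓ)
        t^qℓ≢0 = m*n≢0 (t ^ q) ℓ

    D₀>0 : 0 < D₀
    D₀>0 = *-mono-≤ {1} (>-nonZero⁻¹ t) (≤-trans
      (>-nonZero⁻¹ g {{m*n≢0 (4 * t) (t ^ q * ℓ) {{m*n≢0 4 t}}}}) (m≤n+m g h))

    module _ {n} {D N : ℕ} (bound : Bound H n D N) (D₀≤D : D₀ ≤ D)
             {G : EdgeOrderedGraph n} (avoids : Avoids G H)
             {V : Fin n → Set} (V? : Decidable V) (ends-V : ∀ {e u v} → Joins G e u v → V u)
             (V<N : count V? < 2 ^ T * N) (large : K * D * count V? < size G) where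

      private
        v : ℕ
        v = count V?

        -- Only the first `K * D * v + 1` edges are kept: few enough for `t` intervals of length
        -- `D * N`, yet too many for `edge-budget`.
        prefix : Fin (suc (K * D * v)) → Fin (size G)
        prefix e = inject≤ e large

        prefix-mono : ∀ {e f} → e F.< f → prefix e F.< prefix f
        prefix-mono {e} {f} = subst₂ _<_ (sym (F.toℕ-inject≤ e large)) (sym (F.toℕ-inject≤ f large))

        G′ : EdgeOrderedGraph n
        G′ = subgraph G prefix prefix-mono

        avoids′ : Avoids G′ H
        avoids′ = avoids ∘ contains-subgraph G prefix prefix-mono

        instance
          D≢0 : NonZero D
          D≢0 = >-nonZero (≤-trans D₀>0 D₀≤D)
          N≢0 : NonZero N
          N≢0 = ≢-nonZero λ { refl → n≮0 (≤-trans V<N (≤-reflexive (*-zeroʳ (2 ^ T)))) }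
          DN≢0 : NonZero (D * N)
          DN≢0 = m*n≢0 D N

        size≤ : size G′ ≤ t * (D * N)
        size≤ = begin
          -- The extra edge is absorbed because `V<N` is strict and `K * D` is positive.
          suc (K * D * v)     ≤⟨ +-monoˡ-≤ (K * D * v) (>-nonZero⁻¹ (K * D) {{m*n≢0 K D}}) ⟩
          K * D + K * D * v   ≡⟨ *-suc (K * D) v ⟨
          K * D * suc v       ≤⟨ *-monoʳ-≤ (K * D) V<N ⟩
          K * D * (2 ^ T * N) ≡⟨ rearrange K D (2 ^ T) N ⟩
          2 ^ T * K * (D * N) ∎
          where
          open ≤-Reasoning
          rearrange : ∀ a b c d → a * b * (c * d) ≡ c * a * (b * d)
          rearrange = solve-∀

        J : Fin (size G′) → Fin t
        J = class G′ size≤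

        module R = RichVertices H nonempty forest stars G′ avoids′ V? (λ {e} → ends-V {prefix e})
                     J (class-mono G′ size≤) g
        module S = Split H {D = D} {N = N} bound G′ avoids′ V? (λ {e} → ends-V {prefix e}) J (class-size G′ size≤)

        r : ℕ
        r = count R.rich?

        few-rich : 4 * t * r ≤ v
        few-rich = *-cancelˡ-≤ (t ^ q * ℓ) (begin
          t ^ q * ℓ * (4 * t * r)   ≡⟨ *-assoc (t ^ q * ℓ) (4 * t) r ⟨
          t ^ q * ℓ * (4 * t) * r   ≡⟨ cong (_* r) (*-comm (t ^ q * ℓ) (4 * t)) ⟩
          g * r                     ≤⟨ R.count-rich ⟩
          t ^ q * (ℓ * v)           ≡⟨ *-assoc (t ^ q) ℓ v ⟨
          t ^ q * ℓ * v             ∎)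
          where open ≤-Reasoning

      density-contradiction : ⊥
      density-contradiction = 1+n≰n {K * D * v} (*-cancelʳ-≤ (suc (K * D * v)) (K * D * v) 3
        (≤-trans (S.size-bound q (h + g)) (edge-budget q {D} {D₀} {t} {v} {r} D₀≤D few-rich)))

    step : ∀ {n D N} → D₀ ≤ D → Bound H n D N → Bound H n (K * D) (2 ^ T * N)
    step {n} {D} {N} D₀≤D bound G avoids V? ends-V V<N = ≮⇒≥
      (density-contradiction {n} {D} {N} bound D₀≤D {G} avoids V? ends-V V<N)

    -- With `N = 1` the set `V` is empty, so there is no edge.
    base : ∀ {n} → Bound H n D₀ 1
    base (mkGraph zero _ _ _)    avoids V? ends-V V<1 = z≤n
    base (mkGraph (suc _) _ _ _) avoids V? ends-V V<1 =
      contradiction (∃⇒count>0 V? (ends-V {zero} (inj₁ refl))) (<⇒≱ V<1)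

    iterate : ∀ n r → Bound H n (K ^ r * D₀) ((2 ^ T) ^ r)
    iterate n zero    = subst (λ D → Bound H n D 1) (sym (*-identityˡ D₀)) (base {n})
    iterate n (suc r) = subst (λ D → Bound H n D ((2 ^ T) ^ suc r)) (sym (*-assoc K (K ^ r) D₀))
      (step {n} {K ^ r * D₀} {(2 ^ T) ^ r} (m≤n*m D₀ (K ^ r) {{m^n≢0 K r}}) (iterate n r))

  -- `D₀` is polynomial in `2 ^ T`, with coefficients and degree depending on `H` only.
  moderate-density : Moderate (λ T → K ^ suc T * D₀ T)
  moderate-density = moderate-* (moderate-* (moderate-const K) (moderate-exp K))
    (moderate-* moderate-t (moderate-+ (moderate-const h)
      (moderate-* (moderate-* (moderate-const 4) moderate-t)
                  (moderate-* (moderate-^ q moderate-t) (moderate-const ℓ)))))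
    where
    moderate-t : Moderate t
    moderate-t = moderate-* (moderate-exp 2) (moderate-const K)

  size-bound : ∃ λ C → ∀ {n} T → 1 ≤ T → n ≤ 2 ^ (T * T) → ∀ (G : EdgeOrderedGraph n) → Avoids G H →
               size G ≤ n * 2 ^ (C * T)
  size-bound = C , λ {n} T 1≤T n≤ G avoids → begin
    -- `T` steps reach `2 ^ (T * T)`; one more makes the inequality strict, as `Bound` requires.
    size G                     ≤⟨ iterate T n (suc T) G avoids every? _ (begin-strict
      count {n} every?             ≤⟨ count-all n ⟩
      n                          ≤⟨ n≤ ⟩
      2 ^ (T * T)                ≡⟨ ^-*-assoc 2 T T ⟨
      (2 ^ T) ^ T                <⟨ ^-monoʳ-< (2 ^ T) (^-monoʳ-< 2 (s≤s (s≤s z≤n)) 1≤T) (n<1+n T) ⟩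
      (2 ^ T) ^ suc T            ∎) ⟩
    K ^ suc T * D₀ T * count {n} every?  ≤⟨ *-mono-≤ (density≤ T 1≤T) (count-all n) ⟩
    2 ^ (C * T) * n            ≡⟨ *-comm (2 ^ (C * T)) n ⟩
    n * 2 ^ (C * T)            ∎
    where
    open ≤-Reasoning
    C = proj₁ moderate-density
    density≤ = proj₂ moderate-density
    every? : ∀ {n} → Decidable (λ (_ : Fin n) → ⊤)
    every? _ = yes _
    count-all : ∀ n → count {n} every? ≤ n
    count-all n = count-≤-injection every? (λ e _ → e) (λ _ _ eq → eq)

-- From integral exponents to the square root of the logarithm

^-distribʳ-* : ∀ k a b → (a * b) ^ k ≡ a ^ k * b ^ k
^-distribʳ-* zero    a b = refl
^-distribʳ-* (suc k) a b = trans (cong (a * b *_) (^-distribʳ-* k a b)) (interchange a b (a ^ k) (b ^ k))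
  where
  interchange : ∀ a b x y → a * b * (x * y) ≡ a * x * (b * y)
  interchange = solve-∀

^-cancelˡ-≤ : ∀ {a b} k .{{_ : NonZero k}} → a ^ k ≤ b ^ k → a ≤ b
^-cancelˡ-≤ k a^k≤b^k = ≮⇒≥ λ b<a → <⇒≱ (^-monoˡ-< k b<a) a^k≤b^k

^-cancelʳ-≤ : ∀ {a b} m → 1 < m → m ^ a ≤ m ^ b → a ≤ b
^-cancelʳ-≤ m 1<m m^a≤m^b = ≮⇒≥ λ b<a → <⇒≱ (^-monoʳ-< m 1<m b<a) m^a≤m^b

-- With T = ⌊p/q⌋ + 1, the hypothesis on p/q gives n ≤ 2 ^ T² and T q ≤ 2 p.
√log-bound : ∀ {C m n} → (∀ T → 1 ≤ T → n ≤ 2 ^ (T * T) → m ≤ n * 2 ^ (C * T)) → 2 ≤ n →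
             m ≤ n ·2^⟨ C * 2 ·√log₂ n ⟩
√log-bound {C} {m} {n} bound 2≤n p q n^q²≤2^p² = begin
  m ^ q                       ≤⟨ ^-monoˡ-≤ q (bound T (s≤s z≤n) n≤2^T²) ⟩
  (n * 2 ^ (C * T)) ^ q       ≡⟨ ^-distribʳ-* q n (2 ^ (C * T)) ⟩
  n ^ q * (2 ^ (C * T)) ^ q   ≡⟨ cong (n ^ q *_) (^-*-assoc 2 (C * T) q) ⟩
  n ^ q * 2 ^ (C * T * q)     ≤⟨ *-monoʳ-≤ (n ^ q) (^-monoʳ-≤ 2 exponent) ⟩
  n ^ q * 2 ^ (C * 2 * p)     ∎
  where
  open ≤-Reasoning
  T = suc (p / q)
  instance
    q²≢0 : NonZero (q * q)
    q²≢0 = m*n≢0 q q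
  p≤Tq : p ≤ T * q
  p≤Tq = begin
    p                     ≡⟨ m≡m%n+[m/n]*n p q ⟩
    p % q + p / q * q     ≤⟨ +-monoˡ-≤ (p / q * q) (<⇒≤ (m%n<n p q)) ⟩
    T * q                 ∎
  -- Here `2 ≤ n` enters, through `2 ^ (q * q) ≤ n ^ (q * q)`. Replacing `p/q` by `T` then at most
  -- doubles it, whence the factor 2 in the constant.
  q≤p : q ≤ p
  q≤p = ≮⇒≥ λ p<q → <⇒≱ (*-mono-< p<q p<q)
    (^-cancelʳ-≤ 2 (s≤s (s≤s z≤n)) (≤-trans (^-monoˡ-≤ (q * q) 2≤n) n^q²≤2^p²))
  exponent : C * T * q ≤ C * 2 * p
  exponent = begin
    C * T * q             ≡⟨ *-assoc C T q ⟩
    C * (T * q)           ≤⟨ *-monoʳ-≤ C (+-mono-≤ q≤p (m/n*n≤m p q)) ⟩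
    C * (p + p)           ≡⟨ cong (λ x → C * (p + x)) (+-identityʳ p) ⟨
    C * (2 * p)           ≡⟨ *-assoc C 2 p ⟨
    C * 2 * p             ∎
  n≤2^T² : n ≤ 2 ^ (T * T)
  n≤2^T² = ^-cancelˡ-≤ (q * q) (begin
    n ^ (q * q)               ≤⟨ n^q²≤2^p² ⟩
    2 ^ (p * p)               ≤⟨ ^-monoʳ-≤ 2 (*-mono-≤ p≤Tq p≤Tq) ⟩
    2 ^ (T * q * (T * q))     ≡⟨ cong (2 ^_) (interchange T q) ⟩
    2 ^ (T * T * (q * q))     ≡⟨ ^-*-assoc 2 (T * T) (q * q) ⟨
    (2 ^ (T * T)) ^ (q * q)   ∎)
    where
    interchange : ∀ a b → a * b * (a * b) ≡ a * a * (b * b)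
    interchange = solve-∀

theorem2 : ∀ {h : ℕ} (H : EdgeOrderedGraph h) (nonempty : 0 < size H) →
    IsForest H → OrderChromaticNumberTwo H →
    ∃ λ (C : ℕ) → ∀ (n : ℕ) → 2 ≤ n → ex n H nonempty ≤ n ·2^⟨ C ·√log₂ n ⟩
theorem2 H nonempty forest χ₂ = proj₁ size≤ * 2 , λ n →
  √log-bound {proj₁ size≤} {ex n H nonempty} λ T 1≤T n≤2^T² →
    attained T 1≤T n≤2^T² (proj₁ (ex-isEx n H nonempty))
  where
  size≤ = Iteration.size-bound H nonempty forest (starDecomposition H χ₂)
  attained : ∀ {n m} T → 1 ≤ T → n ≤ 2 ^ (T * T) → Attains n H m → m ≤ n * 2 ^ (proj₁ size≤ * T)
  attained T 1≤T n≤2^T² (G , refl , avoids) = proj₂ size≤ T 1≤T n≤2^T² G avoids
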